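{- Let $G$ be a connected finite simple graph with vertex set $[n]$. Let $d$ be a positive integer such that the vertices $1,\ldots,d$ are pairwise adjacent, and assume the labeling is such that for every $k>1$ the vertex $k$ is adjacent to some vertex of label less than $k$. Let $q$ be an indeterminate and $\widehat\chi_d(q)=\chi_G(q)/(q(q-1)\cdots(q-d+1))$ (a polynomial). Then for every $i\ge0$, the number $(-1)^{n-d-i}[q^i]\widehat\chi_d(q+1)$ equals the number of acyclic orientations of $G$ having exactly $d+i$ source-components, such that the vertices $1,2,\ldots,d$ lie in pairwise different source-components and the vertex $1$ is the unique sink.
   Context: $\chi_G$ is the chromatic polynomial of $G$. A sink is a vertex with no outgoing edge. Source-components of an acyclic orientation $\gamma$ of $G$: for $w\in[n]$ let $R_w$ be the set of vertices reachable from $w$ by a directed path (with $w\in R_w$); define recursively $S_1,S_2,\ldots$: if $\bigcup_{l<k}S_l=[n]$ then $S_k=\emptyset$, otherwise $S_k=R_m\setminus\bigcup_{l<k}S_l$ with $m=\min([n]\setminus\bigcup_{l<k}S_l)$. The non-empty $S_k$ are the source-components. -}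

module Defs where

open import Data.Nat as ℕ using (ℕ; zero; suc; _<_; _≤_; _∸_)
open import Data.Integer as ℤ using (ℤ; +_; -[1+_]; _-_; _^_)
open import Data.Fin using (Fin; toℕ)
open import Data.Vec using (Vec; lookup)
open import Data.Bool using (Bool; true; false)
open import Data.List using (List; []; _∷_; length)
open import Data.List.Membership.Propositional using (_∈_)
open import Data.List.Relation.Unary.Unique.Propositional using (Unique)
open import Data.Product using (Σ; ∃; _×_; _,_)
open import Data.Sum using (_⊎_)
open import Data.Empty using (⊥)
open import Relation.Nullary using (¬_)
open import Relation.Binary.PropositionalEquality using (_≡_; _≢_)
open import Function.Bundles using (_⇔_)

HasCard : {A : Set} → (A → Set) → ℕ → Set
HasCard {A} P c =
  Σ (List A) λ xs → Unique xs × (∀ a → (a ∈ xs) ⇔ P a) × length xs ≡ c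

-- Finite simple graphs on vertex set Fin n
-- (Fin n index j corresponds to the paper's vertex label j+1)

record Graph (n : ℕ) : Set where
  field
    adj    : Fin n → Fin n → Bool
    sym    : ∀ u v → adj u v ≡ adj v u
    irrefl : ∀ v → adj v v ≡ false
open Graph public

data Walk {n : ℕ} (G : Graph n) : Fin n → Fin n → Set where
  nil  : ∀ {u} → Walk G u u
  cons : ∀ {u v w} → adj G u v ≡ true → Walk G v w → Walk G u w

Connected : {n : ℕ} → Graph n → Set
Connected {n} G = ∀ (u v : Fin n) → Walk G u v

-- Chromatic polynomial: χ_G(k) = number of proper colorings with k colours

ProperColoring : {n : ℕ} → Graph n → (k : ℕ) → Vec (Fin k) n → Set
ProperColoring {n} G k c = ∀ (u v : Fin n) → adj G u v ≡ true → lookup c u ≢ lookup c v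

coeff : List ℤ → ℕ → ℤ
coeff []       _       = + 0
coeff (a ∷ as) zero    = a
coeff (a ∷ as) (suc i) = coeff as i

eval : List ℤ → ℤ → ℤ
eval []       x = + 0
eval (a ∷ as) x = a ℤ.+ x ℤ.* eval as x

falling : ℤ → ℕ → ℤ
falling x zero    = + 1
falling x (suc d) = falling x d ℤ.* (x - + d)

Orientation : ℕ → Set
Orientation n = Vec (Vec Bool n) n

arc : {n : ℕ} → Orientation n → Fin n → Fin n → Bool
arc o u v = lookup (lookup o u) v

IsOrientation : {n : ℕ} → Graph n → Orientation n → Set
IsOrientation {n} G o = ∀ (u v : Fin n) →
  (arc o u v ≡ true → adj G u v ≡ true) ×
  (arc o u v ≡ true → arc o v u ≡ false) ×
  (adj G u v ≡ true → arc o u v ≡ true ⊎ arc o v u ≡ true)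

data Path {n : ℕ} (o : Orientation n) : Fin n → Fin n → Set where
  here : ∀ {u} → Path o u u
  step : ∀ {u v w} → arc o u v ≡ true → Path o v w → Path o u w

Acyclic : {n : ℕ} → Orientation n → Set
Acyclic {n} o = ∀ (u v : Fin n) → arc o u v ≡ true → ¬ Path o v u

IsAcyclicOrientation : {n : ℕ} → Graph n → Orientation n → Set
IsAcyclicOrientation G o = IsOrientation G o × Acyclic o

Sink : {n : ℕ} → Orientation n → Fin n → Set
Sink {n} o v = ∀ (u : Fin n) → arc o v u ≡ false

-- Source components S_1, S_2, ... (here 0-indexed: InS o k = S_{k+1})
-- Covered o k v  :  v ∈ S_1 ∪ ... ∪ S_k
-- InS o k v      :  v ∈ R_m \ (S_1 ∪ ... ∪ S_k), m = least uncovered vertex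
--                   (empty if every vertex is covered)

mutual
  Covered : {n : ℕ} → Orientation n → ℕ → Fin n → Set
  Covered o zero    v = ⊥
  Covered o (suc k) v = Covered o k v ⊎ InS o k v

  InS : {n : ℕ} → Orientation n → ℕ → Fin n → Set
  InS {n} o k v =
    Σ (Fin n) λ m →
      (¬ Covered o k m × (∀ (m' : Fin n) → ¬ Covered o k m' → toℕ m ≤ toℕ m'))
      × Path o m v × ¬ Covered o k v

-- the number of non-empty S_k is N (the non-empty ones form an initial segment)
NumSourceComponents : {n : ℕ} → Orientation n → ℕ → Set
NumSourceComponents {n} o N =
  (∀ k → k < N → ∃ λ (v : Fin n) → InS o k v) × ¬ (∃ λ (v : Fin n) → InS o N v)

Counted : {n : ℕ} → Graph n → (d i : ℕ) → (v1 : Fin n) → Orientation n → Set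
Counted {n} G d i v1 o =
  IsAcyclicOrientation G o ×
  NumSourceComponents o (d ℕ.+ i) ×
  (∀ (a b : Fin n) → toℕ a < d → toℕ b < d → a ≢ b →
     ∀ k → InS o k a → ¬ InS o k b) ×
  Sink o v1 × (∀ (v : Fin n) → Sink o v → v ≡ v1)

sign : ℕ → ℤ
sign k = -[1+ 0 ] ^ k

-- The leader of v is the least vertex from which v can be reached; the
-- source-components are the sets of vertices with a common leader. Consider pairs
-- of an acyclic orientation γ and a map f from the vertices to m + 1 colours such
-- that the colour class I of v₁ consists of sinks of γ, f is constant on the part of
-- every source-component outside I, and f is injective on the first d vertices.
-- Sum over all pairs the sign (-1)^(number of non-leaders outside I).
--
-- For fixed γ, a sink s ≠ v₁ has a smaller neighbour, hence is not a leader, and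
-- recolouring it with the colour of v₁ or of its leader changes the sign: only the γ
-- with unique sink v₁ survive. For these, colours can be chosen label by label, which
-- gives (m+1)m⋯(m-d+2) · m^(components - d) maps f if the first d vertices are leaders
-- and none otherwise.
--
-- For fixed f, moving a suitable vertex out of a source-component, so that it becomes
-- one by itself, or back into one, is a sign-reversing involution on the admissible γ
-- if f is not proper; if f is proper, exactly one γ is admissible, and its sign is +1.
--
-- So the sum is χ_G(m+1) on the one hand, and (m+1)m⋯(m-d+2) times a polynomial in m
-- with the required coefficients on the other.
module Submission where

open import Defs renaming (sym to adj-sym; irrefl to adj-irrefl)
open import Data.Nat as ℕ using (ℕ; zero; suc; _<_; _≤_; _∸_; z≤n; s≤s)
open import Data.Nat.Properties as ℕP using (≤-trans)
open import Data.Integer as ℤ using (ℤ; +_; -[1+_]; _+_; _*_; -_; 0ℤ; 1ℤ; -1ℤ; _-_; _^_)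
import Data.Integer.Properties as ℤP
open import Data.Integer.Tactic.RingSolver using (solve-∀)
open import Data.Fin as Fin using (Fin; toℕ; fromℕ<)
import Data.Fin.Properties as FP
open import Data.Fin.Induction using (spo-wellFounded; spo-noetherian)
open import Data.Vec as Vec using (Vec; []; _∷_; _∷ʳ_; lookup; tabulate; _[_]≔_)
import Data.Vec.Properties as VP
open import Data.Bool as Bool using (Bool; true; false; if_then_else_; not)
import Data.Bool.Properties as BP
open import Data.List as List using (List; []; _∷_; length; filter; cartesianProductWith)
import Data.List.Properties as LP
open import Data.Product using (Σ; ∃; _×_; _,_; proj₁; proj₂)
open import Data.Sum using (_⊎_; inj₁; inj₂)
open import Function using (_∘_; id; case_of_)
open import Function.Bundles using (_⇔_; mk⇔; Equivalence)
open import Induction.WellFounded using (Acc; acc)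
open import Relation.Nullary using (¬_; Dec; yes; no; does; contradiction)
open import Relation.Nullary.Decidable using (dec-true; dec-false; decidable-stable; map′; _×-dec_; _⊎-dec_; _→-dec_; ¬?)
open import Relation.Unary using (Decidable)
open import Relation.Binary using (DecidableEquality; IsStrictPartialOrder; tri<; tri≈; tri>)
open import Relation.Binary.PropositionalEquality
  using (_≡_; _≢_; refl; sym; trans; cong; cong₂; subst; isEquivalence; module ≡-Reasoning)
open import Data.List.Membership.Propositional using (_∈_)
open import Data.List.Membership.Propositional.Properties
  using (∈-filter⁺; ∈-filter⁻; ∈-allFin; ∈-cartesianProductWith⁺)
open import Data.List.Membership.Propositional.Properties.WithK using (unique∧set⇒bag)
open import Data.List.Relation.Binary.BagAndSetEquality using (∼bag⇒↭)
open import Data.List.Relation.Binary.Permutation.Propositional.Properties using (↭-length)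
open import Data.List.Relation.Unary.Any using (here; there)
import Data.List.Relation.Unary.All as All
open import Data.List.Relation.Unary.AllPairs using ([]; _∷_)
open import Data.List.Relation.Unary.Unique.Propositional using (Unique)
open import Data.List.Relation.Unary.Unique.Propositional.Properties
  using (filter⁺; allFin⁺; cartesianProductWith⁺)

-- For fixed f the obstacle is that reversing arcs may change leaders far away. An admissible
-- orientation is therefore handled together with its level map g, which sends a vertex to its
-- leader (and a vertex of I to itself), and is described by conditions on single arcs. If s has no
-- arc into its own level, the levels force all arcs at s, so giving s another level and redirecting
-- its edges is reversible. The vertex to move is found thus. Let v be the greatest level that some
-- monochromatic edge outside I joins to a level at or above v. Outside I, the levels above v are
-- then single vertices, and no monochromatic edge joins two of them. Take the colour class of v on
-- levels at or above v, with the edges between level v and the higher levels directed upwards: its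
-- non-isolated sinks other than v are the candidates. Sinks are pairwise non-adjacent, so moving
-- the least candidate changes neither v nor the set of candidates, and the same choice leads back.
-- The shift from q to q + 1 comes from the colour of v₁: with m + 1 colours, each component whose
-- leader lies beyond the first d vertices avoids just that one colour and has m choices.

private variable
  A B : Set
  n : ℕ

-- Finite sums

∑ : List A → (A → ℤ) → ℤ
∑ []       w = 0ℤ
∑ (x ∷ xs) w = w x + ∑ xs w

⟦_⟧ : Dec A → ℤ
⟦ yes _ ⟧ = 1ℤ
⟦ no  _ ⟧ = 0ℤ

⟦⟧-yes : (d : Dec A) → A → ⟦ d ⟧ ≡ 1ℤ
⟦⟧-yes (yes _) _ = refl
⟦⟧-yes (no ¬a) a = contradiction a ¬a

⟦⟧-no : (d : Dec A) → ¬ A → ⟦ d ⟧ ≡ 0ℤ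
⟦⟧-no (yes a) ¬a = contradiction a ¬a
⟦⟧-no (no _)  _  = refl

⟦⟧-cong : (d : Dec A) (e : Dec B) → (A → B) → (B → A) → ⟦ d ⟧ ≡ ⟦ e ⟧
⟦⟧-cong (yes a) e f g = sym (⟦⟧-yes e (f a))
⟦⟧-cong (no ¬a) e f g = sym (⟦⟧-no e (¬a ∘ g))

∑-cong : (xs : List A) {w w' : A → ℤ} → (∀ x → w x ≡ w' x) → ∑ xs w ≡ ∑ xs w'
∑-cong []       e = refl
∑-cong (x ∷ xs) e = cong₂ _+_ (e x) (∑-cong xs e)

∑-zero : (xs : List A) → ∑ xs (λ _ → 0ℤ) ≡ 0ℤ
∑-zero []       = refl
∑-zero (x ∷ xs) = trans (ℤP.+-identityˡ _) (∑-zero xs)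

interchange : ∀ a b c d → (a + b) + (c + d) ≡ (a + c) + (b + d)
interchange = solve-∀

∑-+ : (xs : List A) (w w' : A → ℤ) → ∑ xs (λ x → w x + w' x) ≡ ∑ xs w + ∑ xs w'
∑-+ []       w w' = refl
∑-+ (x ∷ xs) w w' = trans (cong (λ z → w x + w' x + z) (∑-+ xs w w')) (interchange (w x) (w' x) _ _)

∑-*ˡ : (xs : List A) (c : ℤ) (w : A → ℤ) → ∑ xs (λ x → c * w x) ≡ c * ∑ xs w
∑-*ˡ []       c w = sym (ℤP.*-zeroʳ c)
∑-*ˡ (x ∷ xs) c w = trans (cong (λ z → c * w x + z) (∑-*ˡ xs c w)) (sym (ℤP.*-distribˡ-+ c _ _))

∑-neg : (xs : List A) (w : A → ℤ) → ∑ xs (λ x → - w x) ≡ - ∑ xs w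
∑-neg []       w = refl
∑-neg (x ∷ xs) w = trans (cong (λ z → - w x + z) (∑-neg xs w)) (sym (ℤP.neg-distrib-+ (w x) _))

∑-swap : (xs : List A) (ys : List B) (w : A → B → ℤ) →
  ∑ xs (λ x → ∑ ys (w x)) ≡ ∑ ys (λ y → ∑ xs (λ x → w x y))
∑-swap []       ys w = sym (∑-zero ys)
∑-swap (x ∷ xs) ys w = trans (cong (λ z → ∑ ys (w x) + z) (∑-swap xs ys w)) (sym (∑-+ ys (w x) _))

∑-++ : (xs ys : List A) (w : A → ℤ) → ∑ (xs List.++ ys) w ≡ ∑ xs w + ∑ ys w
∑-++ []       ys w = sym (ℤP.+-identityˡ _)
∑-++ (x ∷ xs) ys w = trans (cong (λ z → w x + z) (∑-++ xs ys w)) (sym (ℤP.+-assoc (w x) _ _))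

∑-map : (f : A → B) (xs : List A) (w : B → ℤ) → ∑ (List.map f xs) w ≡ ∑ xs (w ∘ f)
∑-map f []       w = refl
∑-map f (x ∷ xs) w = cong (λ z → w (f x) + z) (∑-map f xs w)

∑-cartesianProductWith : {C : Set} (f : A → B → C) (xs : List A) (ys : List B) (w : C → ℤ) →
  ∑ (cartesianProductWith f xs ys) w ≡ ∑ xs (λ x → ∑ ys (w ∘ f x))
∑-cartesianProductWith f []       ys w = refl
∑-cartesianProductWith f (x ∷ xs) ys w =
  trans (∑-++ (List.map (f x) ys) _ w)
        (cong₂ _+_ (∑-map (f x) ys w) (∑-cartesianProductWith f xs ys w))

∑-vanish : (xs : List A) {w : A → ℤ} → (∀ x → x ∈ xs → w x ≡ 0ℤ) → ∑ xs w ≡ 0ℤ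
∑-vanish []       e = refl
∑-vanish (x ∷ xs) e = cong₂ _+_ (e x (here refl)) (∑-vanish xs (λ y → e y ∘ there))

∑-single : {xs : List A} {w : A → ℤ} → Unique xs → ∀ {a} → a ∈ xs →
  (∀ x → x ≢ a → w x ≡ 0ℤ) → ∑ xs w ≡ w a
∑-single {xs = x ∷ xs} {w} (x∉ ∷ _) (here refl) e =
  trans (cong (λ z → w x + z) (∑-vanish xs (λ y y∈ → e y (All.lookup x∉ y∈ ∘ sym)))) (ℤP.+-identityʳ _)
∑-single {xs = x ∷ xs} {w} (x∉ ∷ u) (there a∈) e =
  trans (cong (_+ ∑ xs w) (e x (All.lookup x∉ a∈))) (trans (ℤP.+-identityˡ _) (∑-single u a∈ e))

-- Finite types, reindexing and sign-reversing involutions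

record Finite (A : Set) : Set where
  field
    elements : List A
    unique   : Unique elements
    complete : ∀ a → a ∈ elements
    _≟_      : DecidableEquality A
open Finite

finiteBool : Finite Bool
finiteBool = record
  { elements = true ∷ false ∷ []
  ; unique   = ((λ ()) All.∷ All.[]) ∷ (All.[] ∷ [])
  ; complete = λ { true → here refl ; false → there (here refl) }
  ; _≟_      = Bool._≟_ }

finiteFin : ∀ k → Finite (Fin k)
finiteFin k = record
  { elements = List.allFin k ; unique = allFin⁺ k ; complete = ∈-allFin ; _≟_ = FP._≟_ }

-- Vectors are enumerated by their initial segment and last entry, so that
-- colourings can be counted label by label.
finiteVec : Finite A → ∀ n → Finite (Vec A n)
finiteVec F n = record
  { elements = vecs n ; unique = vecs! n ; complete = ∈-vecs n ; _≟_ = VP.≡-dec (_≟_ F) }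
  where
  vecs : ∀ n → List (Vec _ n)
  vecs zero    = [] ∷ []
  vecs (suc n) = cartesianProductWith _∷ʳ_ (vecs n) (elements F)
  vecs! : ∀ n → Unique (vecs n)
  vecs! zero    = All.[] ∷ []
  vecs! (suc n) = cartesianProductWith⁺ _∷ʳ_ (VP.∷ʳ-injective _ _) (vecs! n) (unique F)
  ∈-vecs : ∀ n v → v ∈ vecs n
  ∈-vecs zero    []      = here refl
  ∈-vecs (suc n) v with Vec.initLast v
  ... | v' , x , refl = ∈-cartesianProductWith⁺ _∷ʳ_ (∈-vecs n v') (complete F x)

module _ (F : Finite A) where
  private
    xs = elements F

  ∑-δ : {w : A → ℤ} → ∀ a → (∀ x → x ≢ a → w x ≡ 0ℤ) → ∑ xs w ≡ w a
  ∑-δ a = ∑-single (unique F) (complete F a)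

  -- Insert the Kronecker delta of `φ a` and `b` and exchange the two sums: for given `b` the only
  -- contribution comes from `a = φ b`.
  ∑-reindex : (φ : A → A) → (∀ a → φ (φ a) ≡ a) → (w : A → ℤ) → ∑ xs (w ∘ φ) ≡ ∑ xs w
  ∑-reindex φ φφ w = begin
    ∑ xs (w ∘ φ)
      ≡⟨ ∑-cong xs (λ a → sym (trans (∑-δ (φ a) (λ x x≢ → cong (_* w x) (⟦⟧-no (_≟_ F (φ a) x) (x≢ ∘ sym))))
                                     (trans (cong (_* w (φ a)) (⟦⟧-yes (_≟_ F (φ a) (φ a)) refl)) (ℤP.*-identityˡ _)))) ⟩
    ∑ xs (λ a → ∑ xs (λ b → ⟦ _≟_ F (φ a) b ⟧ * w b))
      ≡⟨ ∑-swap xs xs _ ⟩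
    ∑ xs (λ b → ∑ xs (λ a → ⟦ _≟_ F (φ a) b ⟧ * w b))
      ≡⟨ ∑-cong xs (λ b → trans (∑-δ (φ b) (λ x x≢ → cong (_* w b) (⟦⟧-no (_≟_ F (φ x) b)
                                               (λ e → x≢ (trans (sym (φφ x)) (cong φ e))))))
                         (trans (cong (_* w b) (⟦⟧-yes (_≟_ F (φ (φ b)) b) (φφ b))) (ℤP.*-identityˡ _))) ⟩
    ∑ xs w ∎
    where open ≡-Reasoning

  private
    x≡-x⇒x≡0 : ∀ x → x ≡ - x → x ≡ 0ℤ
    x≡-x⇒x≡0 (+ zero)    e = refl
    x≡-x⇒x≡0 (+ (suc n)) ()
    x≡-x⇒x≡0 -[1+ n ]    ()

  -- The partner is a relation, so it has to be produced only where the weight is nonzero; elsewhere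
  -- the identity serves. `R-neg` keeps the partner inside the support, and a point that is its own
  -- partner has weight zero.
  ∑-involution : (R : A → A → Set) (w : A → ℤ) →
    (∀ {a b} → R a b → R b a) →
    (∀ {a b c} → R a b → R a c → b ≡ c) →
    (∀ {a b} → R a b → w b ≡ - w a) →
    (∀ a → w a ≢ 0ℤ → ∃ (R a)) →
    ∑ xs w ≡ 0ℤ
  ∑-involution R w R-sym R-fun R-neg R-tot = x≡-x⇒x≡0 _ (begin
    ∑ xs w              ≡⟨ sym (∑-reindex φ φφ w) ⟩
    ∑ xs (w ∘ φ)        ≡⟨ ∑-cong xs w∘φ ⟩
    ∑ xs (λ a → - w a)  ≡⟨ ∑-neg xs w ⟩
    - ∑ xs w            ∎)
    where
    open ≡-Reasoning
    φ : A → A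
    φ a with w a ℤ.≟ 0ℤ
    ... | yes _  = a
    ... | no w≢0 = proj₁ (R-tot a w≢0)
    φ-cases : ∀ a → (w a ≡ 0ℤ × φ a ≡ a) ⊎ (w a ≢ 0ℤ × R a (φ a))
    φ-cases a with w a ℤ.≟ 0ℤ
    ... | yes w≡0 = inj₁ (w≡0 , refl)
    ... | no w≢0  = inj₂ (w≢0 , proj₂ (R-tot a w≢0))
    w∘φ : ∀ a → w (φ a) ≡ - w a
    w∘φ a with φ-cases a
    ... | inj₁ (w≡0 , e) = trans (cong w e) (trans w≡0 (sym (cong -_ w≡0)))
    ... | inj₂ (_ , r)   = R-neg r
    φφ : ∀ a → φ (φ a) ≡ a
    φφ a with φ-cases a
    ... | inj₁ (_ , e)   = trans (cong φ e) e
    ... | inj₂ (w≢0 , r) with φ-cases (φ a)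
    ...   | inj₁ (w≡0 , _) = contradiction
              (trans (sym (ℤP.neg-involutive (w a))) (cong -_ (trans (sym (R-neg r)) w≡0))) w≢0
    ...   | inj₂ (_ , r')  = R-fun r' (R-sym r)

  module _ {P : A → Set} (P? : Decidable P) where
    private
      length-filter : ∀ ys → + length (filter P? ys) ≡ ∑ ys (λ a → ⟦ P? a ⟧)
      length-filter []       = refl
      length-filter (y ∷ ys) with P? y
      ... | yes _ = cong (λ z → 1ℤ + z) (length-filter ys)
      ... | no  _ = trans (length-filter ys) (sym (ℤP.+-identityˡ _))

    hasCard : HasCard P (length (filter P? xs))
    hasCard = filter P? xs , filter⁺ P? (unique F)
            , (λ a → mk⇔ (proj₂ ∘ ∈-filter⁻ P? {xs = xs}) (∈-filter⁺ P? (complete F a))) , refl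

    -- Two duplicate-free lists with the same members are permutations of each other, so every
    -- witness of `HasCard` has the length of the filtered enumeration.
    card≡∑ : ∀ {c} → HasCard P c → + c ≡ ∑ xs (λ a → ⟦ P? a ⟧)
    card≡∑ {c} (ys , ys! , ys⇔ , refl) = trans (cong +_ (↭-length (∼bag⇒↭ (unique∧set⇒bag ys! (filter⁺ P? (unique F)) same))))
                                           (length-filter xs)
      where
      same : ∀ {a} → a ∈ ys ⇔ a ∈ filter P? xs
      same {a} = mk⇔ (∈-filter⁺ P? (complete F a) ∘ Equivalence.to (ys⇔ a))
                     (Equivalence.from (ys⇔ a) ∘ proj₂ ∘ ∈-filter⁻ P? {xs = xs})

-- Reachability, leaders and source-components

least : {P : Fin n → Set} → Decidable P → ∃ P → Σ (Fin n) λ v → P v × (∀ w → P w → toℕ v ≤ toℕ w)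
least {suc n} P? (w , p) with P? Fin.zero
least {suc n} P? (w , p)         | yes p₀ = Fin.zero , p₀ , λ _ _ → z≤n
least {suc n} P? (Fin.zero , p)  | no ¬p₀ = contradiction p ¬p₀
least {suc n} P? (Fin.suc w , p) | no ¬p₀ =
  let v , q , m = least (P? ∘ Fin.suc) (w , p)
  in Fin.suc v , q , λ { Fin.zero p₀ → contradiction p₀ ¬p₀ ; (Fin.suc x) px → s≤s (m x px) }

greatest : {P : Fin n → Set} → Decidable P → ∃ P → Σ (Fin n) λ v → P v × (∀ w → P w → toℕ w ≤ toℕ v)
greatest {suc n} P? (w , p) with FP.any? (P? ∘ Fin.suc)
greatest {suc n} P? (w , p)         | yes ex =
  let v , q , m = greatest (P? ∘ Fin.suc) ex
  in Fin.suc v , q , λ { Fin.zero _ → z≤n ; (Fin.suc x) px → s≤s (m x px) }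
greatest {suc n} P? (Fin.zero , p)  | no ¬ex =
  Fin.zero , p , λ { Fin.zero _ → z≤n ; (Fin.suc x) px → contradiction (x , px) ¬ex }
greatest {suc n} P? (Fin.suc w , p) | no ¬ex = contradiction (w , p) ¬ex

_▷_ : {o : Orientation n} {u v w : Fin n} → Path o u v → Path o v w → Path o u w
here     ▷ q = q
step a p ▷ q = step a (p ▷ q)

module _ (o : Orientation n) where
  private
    -- Floyd–Warshall: paths whose interior vertices all belong to a given list.
    Via : List (Fin n) → Fin n → Fin n → Set
    Via []       u v = u ≡ v ⊎ arc o u v ≡ true
    Via (p ∷ ps) u v = Via ps u v ⊎ (Via ps u p × Via ps p v)

    via? : ∀ ps u v → Dec (Via ps u v)
    via? []       u v = (u FP.≟ v) ⊎-dec (arc o u v Bool.≟ true)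
    via? (p ∷ ps) u v = via? ps u v ⊎-dec (via? ps u p ×-dec via? ps p v)

    via-arc : ∀ ps {u v} → u ≡ v ⊎ arc o u v ≡ true → Via ps u v
    via-arc []       a = a
    via-arc (p ∷ ps) a = inj₁ (via-arc ps a)

    via-head : ∀ {p ps u} → Via (p ∷ ps) u p → Via ps u p
    via-head (inj₁ x)       = x
    via-head (inj₂ (x , _)) = x

    via-last : ∀ {p ps u} → Via (p ∷ ps) p u → Via ps p u
    via-last (inj₁ x)       = x
    via-last (inj₂ (_ , x)) = x

    -- When both halves pass through `p`, the detour from `p` to `w` and back is dropped, so that
    -- `p` still serves as an interior vertex only once.
    via-trans : ∀ {ps w} → w ∈ ps → ∀ {u v} → Via ps u w → Via ps w v → Via ps u v
    via-trans (here refl) x y = inj₂ (via-head x , via-last y)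
    via-trans (there w∈) (inj₁ x)       (inj₁ y)       = inj₁ (via-trans w∈ x y)
    via-trans (there w∈) (inj₁ x)       (inj₂ (y , z)) = inj₂ (via-trans w∈ x y , z)
    via-trans (there w∈) (inj₂ (x , y)) (inj₁ z)       = inj₂ (x , via-trans w∈ y z)
    via-trans (there w∈) (inj₂ (x , _)) (inj₂ (_ , y)) = inj₂ (x , y)

    via⇒path : ∀ ps {u v} → Via ps u v → Path o u v
    via⇒path []       (inj₁ refl)    = here
    via⇒path []       (inj₂ a)       = step a here
    via⇒path (p ∷ ps) (inj₁ x)       = via⇒path ps x
    via⇒path (p ∷ ps) (inj₂ (x , y)) = via⇒path ps x ▷ via⇒path ps y

    path⇒via : ∀ {u v} → Path o u v → Via (List.allFin n) u v
    path⇒via here                 = via-arc _ (inj₁ refl)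
    path⇒via (step {v = w} a p) = via-trans (∈-allFin w) (via-arc _ (inj₂ a)) (path⇒via p)

  abstract
    path? : ∀ u v → Dec (Path o u v)
    path? u v = map′ (via⇒path _) path⇒via (via? (List.allFin n) u v)

    acyclic? : Dec (Acyclic o)
    acyclic? = FP.all? λ u → FP.all? λ v → (arc o u v Bool.≟ true) →-dec ¬? (path? v u)

    private
      leader′ : ∀ v → Σ (Fin n) λ u → Path o u v × (∀ w → Path o w v → toℕ u ≤ toℕ w)
      leader′ v = least (λ u → path? u v) (v , here)

    leader : Fin n → Fin n
    leader v = proj₁ (leader′ v)

    leader-path : ∀ v → Path o (leader v) v
    leader-path v = proj₁ (proj₂ (leader′ v))

    leader-min : ∀ {u v} → Path o u v → toℕ (leader v) ≤ toℕ u
    leader-min {u} {v} = proj₂ (proj₂ (leader′ v)) u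

  leader-≤ : ∀ v → toℕ (leader v) ≤ toℕ v
  leader-≤ v = leader-min here

  leader-mono : ∀ {u v} → Path o u v → toℕ (leader v) ≤ toℕ (leader u)
  leader-mono {u} p = leader-min (leader-path u ▷ p)

  leader-idem : ∀ v → leader (leader v) ≡ leader v
  leader-idem v = FP.toℕ-injective (ℕP.≤-antisym (leader-≤ _) (leader-mono (leader-path v)))

-- Boolean families on Fin n, extended by false, so that initial segments can be counted.
ext : (Fin n → Bool) → ℕ → Bool
ext {n} b i with i ℕ.<? n
... | yes i<n = b (fromℕ< i<n)
... | no  _   = false

ext-toℕ : (b : Fin n → Bool) (v : Fin n) → ext b (toℕ v) ≡ b v
ext-toℕ {n} b v with toℕ v ℕ.<? n
... | yes p = cong b (FP.fromℕ<-toℕ v p)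
... | no ¬p = contradiction (FP.toℕ<n v) ¬p

ext-true : (b : Fin n → Bool) {i : ℕ} → ext b i ≡ true → ∃ λ v → toℕ v ≡ i × b v ≡ true
ext-true {n} b {i} e with i ℕ.<? n
... | yes p = fromℕ< p , FP.toℕ-fromℕ< p , e
ext-true {n} b {i} () | no _

cnt : (ℕ → Bool) → ℕ → ℕ
cnt b zero    = 0
cnt b (suc k) = (if b k then 1 else 0) ℕ.+ cnt b k

cnt-step : ∀ b k → cnt b k ≤ cnt b (suc k)
cnt-step b k = ℕP.m≤n+m _ (if b k then 1 else 0)

cnt-mono : ∀ b {i j} → i ≤ j → cnt b i ≤ cnt b j
cnt-mono b {i} {j} i≤j = go (ℕP.≤⇒≤′ i≤j)
  where
  go : ∀ {j} → i ℕ.≤′ j → cnt b i ≤ cnt b j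
  go ℕ.≤′-refl     = ℕP.≤-refl
  go (ℕ.≤′-step p) = ℕP.≤-trans (go p) (cnt-step b _)

cnt-true : ∀ b {i} → b i ≡ true → cnt b (suc i) ≡ suc (cnt b i)
cnt-true b {i} e = cong (λ x → (if x then 1 else 0) ℕ.+ cnt b i) e

cnt-false : ∀ b {i} → b i ≡ false → cnt b (suc i) ≡ cnt b i
cnt-false b {i} e = cong (λ x → (if x then 1 else 0) ℕ.+ cnt b i) e

cnt-strict : ∀ b {i j} → i < j → b i ≡ true → cnt b i < cnt b j
cnt-strict b i<j e = ℕP.≤-trans (ℕP.≤-reflexive (sym (cnt-true b e))) (cnt-mono b i<j)

cnt-all-true : ∀ b j → (∀ {i} → i < j → b i ≡ true) → cnt b j ≡ j
cnt-all-true b zero    e = refl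
cnt-all-true b (suc j) e = trans (cnt-true b (e ℕP.≤-refl)) (cong suc (cnt-all-true b j (e ∘ ℕP.m<n⇒m<1+n)))

-- A discrete intermediate value argument: `cnt` grows in steps of at most one, and it leaves the
-- value `k` at a position where `b` is true.
cnt-find : ∀ b x {k} → k < cnt b x → ∃ λ y → y < x × b y ≡ true × cnt b y ≡ k
cnt-find b (suc x) {k} k< with k ℕ.<? cnt b x
... | yes p = let y , y<x , r = cnt-find b x p in y , ℕP.m<n⇒m<1+n y<x , r
... | no ¬p with b x in e
...   | true  = x , ℕP.≤-refl , e , ℕP.≤-antisym (ℕP.≮⇒≥ ¬p) (ℕP.≤-pred k<)
...   | false = contradiction k< ¬p

does-≡true : {A : Set} (d : Dec A) → does d ≡ true → A
does-≡true (yes a) _ = a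

-- Source-components as classes of equal rank

module _ (o : Orientation n) where
  isLeader : Fin n → Bool
  isLeader v = does (leader o v FP.≟ v)

  leaders : ℕ → ℕ
  leaders = cnt (ext isLeader)

  -- The components arise in the order of their leaders, so the number of smaller leaders is the
  -- zero-based index of the component of `v`.
  rank : Fin n → ℕ
  rank v = leaders (toℕ (leader o v))

  private
    ext-leader : ∀ {v} → leader o v ≡ v → ext isLeader (toℕ v) ≡ true
    ext-leader {v} e = trans (ext-toℕ isLeader v) (dec-true (leader o v FP.≟ v) e)

    leaders-leader : ∀ {i} → ext isLeader i ≡ true → ∃ λ v → toℕ v ≡ i × leader o v ≡ v
    leaders-leader {i} e = let v , q , t = ext-true isLeader e in v , q , does-≡true (leader o v FP.≟ v) t

    rank-leader : ∀ v → rank (leader o v) ≡ rank v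
    rank-leader v = cong (leaders ∘ toℕ) (leader-idem o v)

    rank-strict : ∀ {u v} → toℕ (leader o u) < toℕ (leader o v) → rank u < rank v
    rank-strict {u} l = cnt-strict (ext isLeader) l (ext-leader (leader-idem o u))

    find : ∀ x {k} → k < leaders x → ∃ λ v → toℕ v < x × leader o v ≡ v × rank v ≡ k
    find x k< with cnt-find (ext isLeader) x k<
    ... | y , y<x , e , refl with leaders-leader e
    ...   | v , refl , l = v , y<x , l , cong (leaders ∘ toℕ) l

  private
    -- The least uncovered `m` has rank at most `k`, since otherwise a smaller leader of rank `k`
    -- would still be uncovered. Whatever `m` reaches has a leader no larger than that of `m`, hence
    -- rank at most `k`, and the uncovered part has rank at least `k`.
    inS-from-covered : ∀ k → (∀ v → Covered o k v ⇔ rank v < k) → ∀ v → InS o k v ⇔ rank v ≡ k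
    inS-from-covered k ih v = mk⇔ to from
      where
      covered : ∀ {w} → rank w < k → Covered o k w
      covered {w} = Equivalence.from (ih w)
      uncovered : ∀ {w} → ¬ Covered o k w → k ≤ rank w
      uncovered ¬c = ℕP.≮⇒≥ (¬c ∘ covered)
      ≥⇒uncovered : ∀ {w} → k ≤ rank w → ¬ Covered o k w
      ≥⇒uncovered {w} k≤ c = ℕP.≤⇒≯ k≤ (Equivalence.to (ih w) c)
      to : InS o k v → rank v ≡ k
      to (m , (¬cm , m-min) , p , ¬cv) = ℕP.≤-antisym rank-v≤k (uncovered ¬cv)
        where
        rank-m≤k : rank m ≤ k
        rank-m≤k = ℕP.≮⇒≥ λ k<rank →
          let y , y<m , _ , r = find (toℕ (leader o m)) k<rank
          in ℕP.<⇒≱ (ℕP.<-≤-trans y<m (leader-≤ o m)) (m-min y (≥⇒uncovered (ℕP.≤-reflexive (sym r))))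
        rank-v≤k : rank v ≤ k
        rank-v≤k = ℕP.≤-trans (cnt-mono (ext isLeader) (leader-mono o p)) rank-m≤k
      from : rank v ≡ k → InS o k v
      from refl = leader o v , (≥⇒uncovered (ℕP.≤-reflexive (sym (rank-leader v))) , least-uncovered)
                , leader-path o v , ≥⇒uncovered ℕP.≤-refl
        where
        least-uncovered : ∀ w → ¬ Covered o (rank v) w → toℕ (leader o v) ≤ toℕ w
        least-uncovered w ¬c = ℕP.≮⇒≥ λ w<l →
          ℕP.<⇒≱ (rank-strict (ℕP.≤-<-trans (leader-≤ o w) w<l)) (uncovered ¬c)

  covered⇔rank< : ∀ k v → Covered o k v ⇔ rank v < k
  covered⇔rank< zero    v = mk⇔ (λ ()) (λ ())
  covered⇔rank< (suc k) v = mk⇔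
    (λ { (inj₁ c) → ℕP.m<n⇒m<1+n (Equivalence.to (covered⇔rank< k v) c)
       ; (inj₂ s) → s≤s (ℕP.≤-reflexive (Equivalence.to (inS-from-covered k (covered⇔rank< k) v) s)) })
    (λ r<1+k → case ℕP.m≤n⇒m<n∨m≡n (ℕP.≤-pred r<1+k) of λ
       { (inj₁ r<k) → inj₁ (Equivalence.from (covered⇔rank< k v) r<k)
       ; (inj₂ r≡k) → inj₂ (Equivalence.from (inS-from-covered k (covered⇔rank< k) v) r≡k) })

  inS⇔rank≡ : ∀ k v → InS o k v ⇔ rank v ≡ k
  inS⇔rank≡ k = inS-from-covered k (covered⇔rank< k)

  numSourceComponents⇔ : ∀ N → NumSourceComponents o N ⇔ leaders n ≡ N
  numSourceComponents⇔ N = mk⇔ to from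
    where
    rank< : ∀ v → rank v < leaders n
    rank< v = cnt-strict (ext isLeader) (FP.toℕ<n (leader o v)) (ext-leader (leader-idem o v))
    to : NumSourceComponents o N → leaders n ≡ N
    to (occ , ¬more) = ℕP.≤-antisym
      (ℕP.≮⇒≥ λ N< → let v , _ , _ , r = find n N< in ¬more (v , Equivalence.from (inS⇔rank≡ N v) r))
      (N≤ N occ)
      where
      N≤ : ∀ N → (∀ k → k < N → ∃ λ v → InS o k v) → N ≤ leaders n
      N≤ zero    _   = z≤n
      N≤ (suc N) occ = let v , s = occ N ℕP.≤-refl
                       in subst (_< leaders n) (Equivalence.to (inS⇔rank≡ N v) s) (rank< v)
    from : leaders n ≡ N → NumSourceComponents o N
    from refl = (λ k k< → let v , _ , _ , r = find n k< in v , Equivalence.from (inS⇔rank≡ k v) r)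
              , λ { (v , s) → ℕP.<⇒≢ (rank< v) (Equivalence.to (inS⇔rank≡ _ v) s) }

  -- The leader of a vertex below `d` is again below `d` and lies in the same component, so
  -- separation makes the two equal. Conversely, distinct leaders have distinct ranks.
  separated⇔ : ∀ d →
    (∀ (a b : Fin n) → toℕ a < d → toℕ b < d → a ≢ b → ∀ k → InS o k a → ¬ InS o k b) ⇔
    (∀ a → toℕ a < d → leader o a ≡ a)
  separated⇔ d = mk⇔ to from
    where
    to : _ → ∀ a → toℕ a < d → leader o a ≡ a
    to sep a a<d with leader o a FP.≟ a
    ... | yes l = l
    ... | no ¬l = contradiction (Equivalence.from (inS⇔rank≡ (rank a) (leader o a)) (rank-leader a))
          (sep a (leader o a) a<d (ℕP.≤-<-trans (leader-≤ o a) a<d) (¬l ∘ sym) (rank a)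
            (Equivalence.from (inS⇔rank≡ (rank a) a) refl))
    rank≡⇒≡ : ∀ {u v} → leader o u ≡ u → leader o v ≡ v → rank u ≡ rank v → u ≡ v
    rank≡⇒≡ {u} {v} lu lv e with ℕP.<-cmp (toℕ (leader o u)) (toℕ (leader o v))
    ... | tri< l _ _ = contradiction e (ℕP.<⇒≢ (rank-strict l))
    ... | tri≈ _ q _ = trans (sym lu) (trans (FP.toℕ-injective q) lv)
    ... | tri> _ _ l = contradiction (sym e) (ℕP.<⇒≢ (rank-strict l))
    from : (∀ a → toℕ a < d → leader o a ≡ a) → _
    from l a b a<d b<d a≢b k sa sb = a≢b (rank≡⇒≡ (l a a<d) (l b b<d)
      (trans (Equivalence.to (inS⇔rank≡ k a) sa) (sym (Equivalence.to (inS⇔rank≡ k b) sb))))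

-- The signed sum over orientations for a fixed colouring

lookup-ext : {A : Set} {xs ys : Vec A n} → (∀ i → lookup xs i ≡ lookup ys i) → xs ≡ ys
lookup-ext {xs = xs} {ys} e =
  trans (sym (VP.tabulate∘lookup xs)) (trans (VP.tabulate-cong e) (VP.tabulate∘lookup ys))

matrix : (Fin n → Fin n → Bool) → Orientation n
matrix b = tabulate λ u → tabulate (b u)

arc-matrix : (b : Fin n → Fin n → Bool) → ∀ u v → arc (matrix b) u v ≡ b u v
arc-matrix b u v = trans (cong (λ r → lookup r v) (VP.lookup∘tabulate _ u)) (VP.lookup∘tabulate (b u) v)

path-last : {o : Orientation n} {u v : Fin n} → Path o u v → u ≡ v ⊎ (∃ λ w → Path o u w × arc o w v ≡ true)
path-last here = inj₁ refl
path-last (step a p) with path-last p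
... | inj₁ refl        = inj₂ (_ , here , a)
... | inj₂ (w , q , b) = inj₂ (w , step a q , b)

-- Reachability along at least one arc: for acyclic `o` a strict order on a finite set, which
-- permits recursion both against and along the arcs.
_⊢_⊏_ : Orientation n → Fin n → Fin n → Set
o ⊢ u ⊏ v = ∃ λ w → arc o u w ≡ true × Path o w v

⊏-isStrictPartialOrder : {o : Orientation n} → Acyclic o → IsStrictPartialOrder _≡_ (o ⊢_⊏_)
⊏-isStrictPartialOrder ac = record
  { isEquivalence = isEquivalence
  ; irrefl        = λ { refl (w , a , p) → ac _ w a p }
  ; trans         = λ { (w , a , p) (w′ , a′ , p′) → w , a , (p ▷ step a′ p′) }
  ; <-resp-≈      = (λ { refl r → r }) , (λ { refl r → r }) }

true≢false : ∀ {b} → b ≡ true → b ≢ false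
true≢false refl ()

module _ (G : Graph n) where
  isOrientation? : Decidable (IsOrientation G)
  isOrientation? o = FP.all? λ u → FP.all? λ v →
    ((arc o u v Bool.≟ true) →-dec (adj G u v Bool.≟ true)) ×-dec
    ((arc o u v Bool.≟ true) →-dec (arc o v u Bool.≟ false)) ×-dec
    ((adj G u v Bool.≟ true) →-dec ((arc o u v Bool.≟ true) ⊎-dec (arc o v u Bool.≟ true)))

  module Oriented {o : Orientation n} (O : IsOrientation G o) where
    arc⇒adj : ∀ {u v} → arc o u v ≡ true → adj G u v ≡ true
    arc⇒adj {u} {v} = proj₁ (O u v)
    arc-asym : ∀ {u v} → arc o u v ≡ true → arc o v u ≢ true
    arc-asym {u} {v} a b = true≢false b (proj₁ (proj₂ (O u v)) a)
    adj⇒arc : ∀ {u v} → adj G u v ≡ true → arc o u v ≡ true ⊎ arc o v u ≡ true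
    adj⇒arc {u} {v} = proj₂ (proj₂ (O u v))
    arc-irrefl : ∀ {u} → arc o u u ≢ true
    arc-irrefl {u} a = true≢false (arc⇒adj a) (adj-irrefl G u)

  adj-symm : ∀ {u v} → adj G u v ≡ true → adj G v u ≡ true
  adj-symm {u} {v} e = trans (adj-sym G v u) e

  mkOrientation : {o : Orientation n} →
    (∀ {u v} → arc o u v ≡ true → adj G u v ≡ true) →
    (∀ {u v} → arc o u v ≡ true → arc o v u ≢ true) →
    (∀ {u v} → adj G u v ≡ true → arc o u v ≡ true ⊎ arc o v u ≡ true) → IsOrientation G o
  mkOrientation {o} p q r u v = p , (λ a → BP.¬-not (q a)) , r

  -- Both orientations contain exactly one arc for each edge, so neither can properly contain the
  -- other.
  orientation-⊆⇒≡ : {o o′ : Orientation n} → IsOrientation G o → IsOrientation G o′ →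
    (∀ {u v} → arc o u v ≡ true → arc o′ u v ≡ true) → o ≡ o′
  orientation-⊆⇒≡ {o} {o′} O O′ sub = lookup-ext λ u → lookup-ext λ v → BP.⇔→≡ {z = true} (mk⇔ sub (back u v))
    where
    back : ∀ u v → arc o′ u v ≡ true → arc o u v ≡ true
    back u v a′ with Oriented.adj⇒arc {o} O (Oriented.arc⇒adj {o′} O′ a′)
    ... | inj₁ a = a
    ... | inj₂ b = contradiction (sub b) (Oriented.arc-asym {o′} O′ a′)

orientations : ∀ n → List (Orientation n)
orientations n = Finite.elements (finiteVec (finiteVec finiteBool n) n)

-- Minus one to the number of false values below `j`, written as a product so that changing one
-- value visibly changes the sign.
signs : (ℕ → Bool) → ℕ → ℤ
signs b zero    = 1ℤ
signs b (suc j) = (if b j then 1ℤ else -1ℤ) * signs b j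

signs-cong : ∀ {b b′} j → (∀ {i} → i < j → b i ≡ b′ i) → signs b j ≡ signs b′ j
signs-cong zero    e = refl
signs-cong (suc j) e = cong₂ (λ x y → (if x then 1ℤ else -1ℤ) * y) (e ℕP.≤-refl)
  (signs-cong j (λ i<j → e (ℕP.m<n⇒m<1+n i<j)))

signs-flip : ∀ {b b′ p} j → p < j → (∀ {i} → i ≢ p → b i ≡ b′ i) → b p ≡ not (b′ p) →
  signs b j ≡ - signs b′ j
signs-flip {b} {b′} {p} (suc j) p<1+j e e-p with p ℕ.≟ j
... | yes refl = trans (cong₂ (λ x y → (if x then 1ℤ else -1ℤ) * y) e-p
                         (signs-cong j (λ i<j → e (ℕP.<⇒≢ i<j))))
                       (negate (b′ p) (signs b′ p))
  where
  negate : ∀ x y → (if not x then 1ℤ else -1ℤ) * y ≡ - ((if x then 1ℤ else -1ℤ) * y)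
  negate true  y = trans (ℤP.-1*i≡-i y) (cong -_ (sym (ℤP.*-identityˡ y)))
  negate false y = trans (ℤP.*-identityˡ y) (sym (trans (cong -_ (ℤP.-1*i≡-i y)) (ℤP.neg-involutive y)))
... | no p≢j = trans (cong₂ (λ x y → (if x then 1ℤ else -1ℤ) * y) (e (p≢j ∘ sym))
                       (signs-flip j (ℕP.≤∧≢⇒< (ℕP.≤-pred p<1+j) p≢j) e e-p))
                     (sym (ℤP.neg-distribʳ-* (if b′ j then 1ℤ else -1ℤ) (signs b′ j)))

ext-off : {b b′ : Fin n → Bool} {s : Fin n} → (∀ {v} → v ≢ s → b v ≡ b′ v) →
  ∀ {i} → i ≢ toℕ s → ext b i ≡ ext b′ i
ext-off {n} {s = s} e {i} i≢ with i ℕ.<? n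
... | yes p = e (λ q → i≢ (trans (sym (FP.toℕ-fromℕ< p)) (cong toℕ q)))
... | no  _ = refl

signs-ext-flip : (b b′ : Fin n → Bool) (s : Fin n) → (∀ {v} → v ≢ s → b v ≡ b′ v) → b s ≡ not (b′ s) →
  signs (ext b) n ≡ - signs (ext b′) n
signs-ext-flip {n} b b′ s e e-s = signs-flip n (FP.toℕ<n s) (ext-off e)
  (trans (ext-toℕ b s) (trans e-s (cong not (sym (ext-toℕ b′ s)))))

fixes : Vec (Fin n) n → Fin n → Bool
fixes g v = does (lookup g v FP.≟ v)

-- A colour c₀ is singled out: its class is required to consist of sinks, while
-- f has to be constant on the part of every source component outside that class.
module Coloured {n k : ℕ} (G : Graph n) (c₀ : Fin k) (f : Fin n → Fin k) where

  Valid : Orientation n → Set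
  Valid o = IsAcyclicOrientation G o × (∀ v → f v ≡ c₀ → Sink o v)
          × (∀ v → f v ≢ c₀ → f (leader o v) ≡ f v)

  abstract
    valid? : Decidable Valid
    valid? o = (isOrientation? G o ×-dec acyclic? o)
      ×-dec (FP.all? λ v → (f v FP.≟ c₀) →-dec FP.all? λ u → arc o v u Bool.≟ false)
      ×-dec (FP.all? λ v → ¬? (f v FP.≟ c₀) →-dec (f (leader o v) FP.≟ f v))

  abstract
    -- A vertex of colour `c₀` is made its own leader. The vertices not fixed are then exactly the
    -- non-leaders outside the singled-out class, so the sign can be read off from `lead o` alone.
    lead : Orientation n → Vec (Fin n) n
    lead o = tabulate λ v → if does (f v FP.≟ c₀) then v else leader o v

    lead-c₀ : ∀ o {v} → f v ≡ c₀ → lookup (lead o) v ≡ v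
    lead-c₀ o {v} e = trans (VP.lookup∘tabulate _ v)
      (cong (λ b → if b then v else leader o v) (dec-true (f v FP.≟ c₀) e))

    lead-≢c₀ : ∀ o {v} → f v ≢ c₀ → lookup (lead o) v ≡ leader o v
    lead-≢c₀ o {v} e = trans (VP.lookup∘tabulate _ v)
      (cong (λ b → if b then v else leader o v) (dec-false (f v FP.≟ c₀) e))

  -- A local characterisation of validity together with g ≡ lead o.
  record Cert (o : Orientation n) (g : Vec (Fin n) n) : Set where
    field
      oriented : IsOrientation G o
      acyclic  : Acyclic o
      sinks    : ∀ {v u} → f v ≡ c₀ → arc o v u ≢ true
      g-c₀     : ∀ {v} → f v ≡ c₀ → lookup g v ≡ v
      g-mono   : ∀ {u v} → arc o u v ≡ true → f v ≢ c₀ → toℕ (lookup g v) ≤ toℕ (lookup g u)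
      g-≤      : ∀ v → toℕ (lookup g v) ≤ toℕ v
      g-idem   : ∀ v → lookup g (lookup g v) ≡ lookup g v
      g-colour : ∀ v → f (lookup g v) ≡ f v
      g-pred   : ∀ {v} → lookup g v ≢ v → ∃ λ u → arc o u v ≡ true × lookup g u ≡ lookup g v
    open Oriented G {o} oriented public

    path-≢c₀ : ∀ {u v} → Path o u v → f v ≢ c₀ → f u ≢ c₀
    path-≢c₀ here       ¬v = ¬v
    path-≢c₀ (step a p) ¬v = λ e → sinks e a

    path-mono : ∀ {u v} → Path o u v → f v ≢ c₀ → toℕ (lookup g v) ≤ toℕ (lookup g u)
    path-mono here       ¬v = ℕP.≤-refl
    path-mono (step a p) ¬v = ℕP.≤-trans (path-mono p ¬v) (g-mono a (path-≢c₀ p ¬v))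

    -- Stepping back along `g-pred` keeps the value of `g`, and acyclicity makes it stop. It can
    -- stop only at a vertex fixed by `g`, which is then `lookup g v` itself.
    g-path : ∀ v → Path o (lookup g v) v
    g-path v = go v (spo-wellFounded (⊏-isStrictPartialOrder {o = o} acyclic) v)
      where
      go : ∀ v → Acc (o ⊢_⊏_) v → Path o (lookup g v) v
      go v (acc rs) with lookup g v FP.≟ v
      ... | yes e = subst (λ u → Path o u v) (sym e) here
      ... | no ¬e with g-pred ¬e
      ...   | u , a , e = subst (λ w → Path o w v) e (go u (rs (v , a , here)) ▷ step a here)

    -- The leader is no larger because `lookup g v` reaches `v`. It is no smaller because `g` never
    -- rises along the path from the leader to `v` and starts there with a value at most the leader.
    leader≡g : ∀ {v} → f v ≢ c₀ → leader o v ≡ lookup g v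
    leader≡g {v} ¬v = FP.toℕ-injective (ℕP.≤-antisym (leader-min o (g-path v))
      (ℕP.≤-trans (path-mono (leader-path o v) ¬v) (g-≤ (leader o v))))

    cert⇒lead : lead o ≡ g
    cert⇒lead = lookup-ext λ v → case f v FP.≟ c₀ of λ where
      (yes e) → trans (lead-c₀ o e) (sym (g-c₀ e))
      (no ¬e) → trans (lead-≢c₀ o ¬e) (leader≡g ¬e)

    cert⇒valid : Valid o
    cert⇒valid = (oriented , acyclic)
      , (λ v e u → BP.¬-not (sinks e))
      , (λ v ¬e → trans (cong f (leader≡g ¬e)) (g-colour v))

  valid⇒cert : ∀ {o} → Valid o → Cert o (lead o)
  valid⇒cert {o} ((O , ac) , snk , col) = record
    { oriented = O ; acyclic = ac ; sinks = sinks ; g-c₀ = lead-c₀ o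
    ; g-mono = g-mono ; g-≤ = g-≤ ; g-idem = g-idem ; g-colour = g-colour ; g-pred = g-pred }
    where
    g : Fin n → Fin n
    g = lookup (lead o)
    sinks : ∀ {v u} → f v ≡ c₀ → arc o v u ≢ true
    sinks {v} {u} e a = true≢false a (snk v e u)
    g-mono : ∀ {u v} → arc o u v ≡ true → f v ≢ c₀ → toℕ (g v) ≤ toℕ (g u)
    g-mono {u} {v} a ¬v rewrite lead-≢c₀ o ¬v | lead-≢c₀ o {u} (λ e → sinks e a) = leader-mono o (step a here)
    g-≤ : ∀ v → toℕ (g v) ≤ toℕ v
    g-≤ v with f v FP.≟ c₀
    ... | yes e = ℕP.≤-reflexive (cong toℕ (lead-c₀ o e))
    ... | no ¬e = subst (λ w → toℕ w ≤ toℕ v) (sym (lead-≢c₀ o ¬e)) (leader-≤ o v)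
    g-colour : ∀ v → f (g v) ≡ f v
    g-colour v with f v FP.≟ c₀
    ... | yes e = cong f (lead-c₀ o e)
    ... | no ¬e = trans (cong f (lead-≢c₀ o ¬e)) (col v ¬e)
    g-idem : ∀ v → g (g v) ≡ g v
    g-idem v with f v FP.≟ c₀
    ... | yes e = cong g (lead-c₀ o e)
    ... | no ¬e = trans (lead-≢c₀ o (λ e → ¬e (trans (sym (g-colour v)) e)))
          (trans (cong (leader o) (lead-≢c₀ o ¬e)) (trans (leader-idem o v) (sym (lead-≢c₀ o ¬e))))
    g-pred : ∀ {v} → g v ≢ v → ∃ λ u → arc o u v ≡ true × g u ≡ g v
    g-pred {v} g≢ with path-last (subst (λ w → Path o w v) (sym (lead-≢c₀ o ¬e)) (leader-path o v))
      where
      ¬e : f v ≢ c₀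
      ¬e e = g≢ (lead-c₀ o e)
    ... | inj₁ e = contradiction e g≢
    ... | inj₂ (w , p , a) = w , a , FP.toℕ-injective (ℕP.≤-antisym gw≤gv (g-mono a ¬e))
      where
      ¬e : f v ≢ c₀
      ¬e e = g≢ (lead-c₀ o e)
      gw≤gv : toℕ (g w) ≤ toℕ (g v)
      gw≤gv = subst (λ x → toℕ x ≤ toℕ (g v)) (sym (lead-≢c₀ o {w} (λ e → sinks e a))) (leader-min o p)

  -- Redirecting the edges at one vertex

  data Redirected (o : Orientation n) (h : Vec (Fin n) n) (s : Fin n) : Fin n → Fin n → Set where
    leaving  : ∀ {y} → adj G s y ≡ true → f y ≡ c₀ ⊎ toℕ (lookup h y) < toℕ (lookup h s) → Redirected o h s s y
    entering : ∀ {x} → x ≢ s → adj G x s ≡ true → f x ≢ c₀ → toℕ (lookup h s) ≤ toℕ (lookup h x) →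
               Redirected o h s x s
    away     : ∀ {x y} → x ≢ s → y ≢ s → arc o x y ≡ true → Redirected o h s x y

  redirected? : ∀ o h s x y → Dec (Redirected o h s x y)
  redirected? o h s x y with x FP.≟ s | y FP.≟ s
  ... | yes refl | _ = map′ (λ { (a , b) → leaving a b })
        (λ { (leaving a b) → a , b ; (entering x≢ _ _ _) → contradiction refl x≢ ; (away x≢ _ _) → contradiction refl x≢ })
        ((adj G s y Bool.≟ true) ×-dec ((f y FP.≟ c₀) ⊎-dec (toℕ (lookup h y) ℕ.<? toℕ (lookup h s))))
  ... | no x≢ | yes refl = map′ (λ { (a , b , c) → entering x≢ a b c })
        (λ { (leaving _ _) → contradiction refl x≢ ; (entering _ a b c) → a , b , c ; (away _ y≢ _) → contradiction refl y≢ })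
        ((adj G x s Bool.≟ true) ×-dec (¬? (f x FP.≟ c₀) ×-dec (toℕ (lookup h s) ℕ.≤? toℕ (lookup h x))))
  ... | no x≢ | no y≢ = map′ (away x≢ y≢)
        (λ { (leaving _ _) → contradiction refl x≢ ; (entering _ _ _ _) → contradiction refl y≢ ; (away _ _ a) → a })
        (arc o x y Bool.≟ true)

  -- The edges at `s` go out to the singled-out class and to strictly lower levels of `h`, while
  -- ties come in; all other arcs stay. This is the only choice once levels may not rise along arcs
  -- and `s` has no arc into its own level.
  redirect : Orientation n → Vec (Fin n) n → Fin n → Orientation n
  redirect o h s = matrix λ x y → does (redirected? o h s x y)

  module _ {o : Orientation n} {h : Vec (Fin n) n} {s : Fin n} where
    arc⇒redirected : ∀ {x y} → arc (redirect o h s) x y ≡ true → Redirected o h s x y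
    arc⇒redirected {x} {y} a = does-≡true (redirected? o h s x y) (trans (sym (arc-matrix _ x y)) a)

    redirected⇒arc : ∀ {x y} → Redirected o h s x y → arc (redirect o h s) x y ≡ true
    redirected⇒arc {x} {y} r = trans (arc-matrix _ x y) (dec-true (redirected? o h s x y) r)

    redirect-orientation : IsOrientation G o → f s ≢ c₀ → IsOrientation G (redirect o h s)
    redirect-orientation O ¬s = mkOrientation G {redirect o h s} ⊆adj asym total
      where
      open Oriented G {o} O
      ⊆adj : ∀ {u v} → arc (redirect o h s) u v ≡ true → adj G u v ≡ true
      ⊆adj {u} {v} a with arc⇒redirected {u} {v} a
      ... | leaving b _      = b
      ... | entering _ b _ _ = b
      ... | away _ _ b       = arc⇒adj b
      asym : ∀ {u v} → arc (redirect o h s) u v ≡ true → arc (redirect o h s) v u ≢ true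
      asym {u} {v} a b with arc⇒redirected {u} {v} a | arc⇒redirected {v} {u} b
      ... | leaving p _        | leaving _ _            = true≢false p (adj-irrefl G s)
      ... | leaving _ (inj₁ e) | entering _ _ ¬e _      = ¬e e
      ... | leaving _ (inj₂ l) | entering _ _ _ l′      = ℕP.<⇒≱ l l′
      ... | leaving _ _        | away _ s≢ _            = s≢ refl
      ... | entering _ _ ¬e _  | leaving _ (inj₁ e)     = ¬e e
      ... | entering _ _ _ l′  | leaving _ (inj₂ l)     = ℕP.<⇒≱ l l′
      ... | entering s≢ _ _ _  | entering _ _ _ _       = s≢ refl
      ... | entering _ _ _ _   | away s≢ _ _            = s≢ refl
      ... | away _ s≢ _        | leaving _ _            = s≢ refl
      ... | away s≢ _ _        | entering _ _ _ _       = s≢ refl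
      ... | away _ _ p         | away _ _ q             = arc-asym p q
      total : ∀ {u v} → adj G u v ≡ true → arc (redirect o h s) u v ≡ true ⊎ arc (redirect o h s) v u ≡ true
      total {u} {v} a with u FP.≟ s | v FP.≟ s
      ... | yes refl | yes refl = contradiction (adj-irrefl G s) (true≢false a)
      ... | yes refl | no v≢ with (f v FP.≟ c₀) ⊎-dec (toℕ (lookup h v) ℕ.<? toℕ (lookup h s))
      ...   | yes l = inj₁ (redirected⇒arc (leaving a l))
      ...   | no ¬l = inj₂ (redirected⇒arc (entering v≢ (adj-symm G a) (¬l ∘ inj₁) (ℕP.≮⇒≥ (¬l ∘ inj₂))))
      total {u} {v} a | no u≢ | yes refl with (f u FP.≟ c₀) ⊎-dec (toℕ (lookup h u) ℕ.<? toℕ (lookup h s))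
      ...   | yes l = inj₂ (redirected⇒arc (leaving (adj-symm G a) l))
      ...   | no ¬l = inj₁ (redirected⇒arc (entering u≢ a (¬l ∘ inj₁) (ℕP.≮⇒≥ (¬l ∘ inj₂))))
      total {u} {v} a | no u≢ | no v≢ with adj⇒arc a
      ...   | inj₁ b = inj₁ (redirected⇒arc (away u≢ v≢ b))
      ...   | inj₂ b = inj₂ (redirected⇒arc (away v≢ u≢ b))

  -- The vertex `s` receives the level `z`. By `level`, no vertex outside the singled-out class
  -- relies on `s` as its `g-pred`, and the arcs of `o` at `s` are those that redirection along `g`
  -- produces, which gives `restore`. If `s` joins another level, `pred` supplies its own
  -- predecessor there.
  module Redirect {o : Orientation n} {g : Vec (Fin n) n} (C : Cert o g) (s z : Fin n) (¬s : f s ≢ c₀)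
    (z≤s : toℕ z ≤ toℕ s) (fz : f z ≡ f s) (level : ∀ {y} → arc o s y ≡ true → f y ≢ c₀ → lookup g y ≢ lookup g s)
    (idem : ∀ x → lookup (g [ s ]≔ z) (lookup (g [ s ]≔ z) x) ≡ lookup (g [ s ]≔ z) x)
    (pred : z ≢ s → ∃ λ u → u ≢ s × adj G u s ≡ true × f u ≢ c₀ × lookup g u ≡ z)
    where
    open Cert C

    g′ : Vec (Fin n) n
    g′ = g [ s ]≔ z

    o′ : Orientation n
    o′ = redirect o g′ s

    g′-s : lookup g′ s ≡ z
    g′-s = VP.lookup∘update s g z

    g′-off : ∀ {x} → x ≢ s → lookup g′ x ≡ lookup g x
    g′-off x≢ = VP.lookup∘update′ x≢ g z

    private
      sinks′ : ∀ {v u} → f v ≡ c₀ → arc o′ v u ≢ true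
      sinks′ {v} {u} e a with arc⇒redirected {o} {g′} {s} {v} {u} a
      ... | leaving _ _       = ¬s e
      ... | entering _ _ ¬e _ = ¬e e
      ... | away _ _ b        = sinks e b

      mono′ : ∀ {u v} → arc o′ u v ≡ true → f v ≢ c₀ → toℕ (lookup g′ v) ≤ toℕ (lookup g′ u)
      mono′ {u} {v} a ¬v with arc⇒redirected {o} {g′} {s} {u} {v} a
      ... | leaving _ (inj₁ e) = contradiction e ¬v
      ... | leaving _ (inj₂ l) = ℕP.<⇒≤ l
      ... | entering _ _ _ l   = l
      ... | away u≢ v≢ b rewrite g′-off u≢ | g′-off v≢ = g-mono b ¬v

      path-mono′ : ∀ {u v} → Path o′ u v → f v ≢ c₀ → f u ≢ c₀ × toℕ (lookup g′ v) ≤ toℕ (lookup g′ u)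
      path-mono′ here       ¬v = ¬v , ℕP.≤-refl
      path-mono′ (step a p) ¬v = let ¬w , l = path-mono′ p ¬v in
        (λ e → sinks′ e a) , ℕP.≤-trans l (mono′ a ¬w)

      -- Arcs leaving s strictly lower the level, so s lies on no cycle.
      leave-< : ∀ {y v} → arc o′ s y ≡ true → Path o′ y v → f v ≢ c₀ → toℕ (lookup g′ v) < toℕ (lookup g′ s)
      leave-< {y} a p ¬v with arc⇒redirected {o} {g′} {s} {s} {y} a | path-mono′ p ¬v
      ... | leaving _ (inj₁ e)   | ¬y , _ = contradiction e ¬y
      ... | leaving _ (inj₂ l)   | _ , l′ = ℕP.≤-<-trans l′ l
      ... | entering s≢ _ _ _    | _      = contradiction refl s≢
      ... | away s≢ _ _          | _      = contradiction refl s≢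

      -- Levels never rise along a new path, so one whose end is not lower than its start stays on
      -- one level. It cannot leave `s`, which would lower the level, and it does not end in `s`;
      -- hence it uses old arcs only.
      old-path : ∀ {u v} → Path o′ u v → f v ≢ c₀ → v ≢ s → toℕ (lookup g′ u) ≤ toℕ (lookup g′ v) →
        u ≢ s × Path o u v
      old-path here ¬v v≢ l = v≢ , here
      old-path {u} {v} (step {v = w} a p) ¬v v≢ l with u FP.≟ s
      ... | yes refl = contradiction l (ℕP.<⇒≱ (leave-< a p ¬v))
      ... | no u≢ with old-path p ¬v v≢ (ℕP.≤-trans (mono′ a (proj₁ (path-mono′ p ¬v))) l)
      ...   | w≢ , q with arc⇒redirected {o} {g′} {s} {u} {w} a
      ...     | leaving _ _      = contradiction refl u≢
      ...     | entering _ _ _ _ = contradiction refl w≢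
      ...     | away _ _ b       = u≢ , step b q

      acyclic′ : Acyclic o′
      acyclic′ u v a p with u FP.≟ s
      ... | yes refl = ℕP.<-irrefl refl (leave-< a p ¬s)
      ... | no u≢ with old-path p ¬u u≢ (mono′ a (proj₁ (path-mono′ p ¬u)))
        where
        ¬u : f u ≢ c₀
        ¬u e = sinks′ e a
      ...   | v≢ , q with arc⇒redirected {o} {g′} {s} {u} {v} a
      ...     | leaving _ _      = u≢ refl
      ...     | entering _ _ _ _ = v≢ refl
      ...     | away _ _ b       = acyclic u v b q

      pred′ : ∀ {v} → lookup g′ v ≢ v → ∃ λ u → arc o′ u v ≡ true × lookup g′ u ≡ lookup g′ v
      pred′ {v} g≢ with v FP.≟ s
      ... | yes refl with pred (λ e → g≢ (trans g′-s e))
      ...   | u , u≢ , a , ¬u , e = u , redirected⇒arc (entering u≢ a ¬u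
                  (ℕP.≤-reflexive (cong toℕ (sym same)))) , same
        where
        same : lookup g′ u ≡ lookup g′ s
        same = trans (g′-off u≢) (trans e (sym g′-s))
      pred′ {v} g≢ | no v≢ with g-pred (λ e → g≢ (trans (g′-off v≢) e))
      ...   | u , a , e = u , redirected⇒arc (away u≢ v≢ a) , trans (g′-off u≢) (trans e (sym (g′-off v≢)))
        where
        u≢ : u ≢ s
        u≢ refl = level a (λ ev → g≢ (trans (g′-off v≢) (g-c₀ ev))) (sym e)

    cert′ : Cert o′ g′
    cert′ = record
      { oriented = redirect-orientation {o} {g′} {s} oriented ¬s
      ; acyclic  = acyclic′
      ; sinks    = sinks′
      ; g-c₀     = λ {v} e → trans (g′-off {v} (λ { refl → ¬s e })) (g-c₀ e)
      ; g-mono   = mono′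
      ; g-≤      = g′-≤
      ; g-idem   = idem
      ; g-colour = g′-colour
      ; g-pred   = pred′ }
      where
      g′-≤ : ∀ v → toℕ (lookup g′ v) ≤ toℕ v
      g′-≤ v with v FP.≟ s
      ... | yes refl = subst (λ x → toℕ x ≤ toℕ s) (sym g′-s) z≤s
      ... | no v≢    = subst (λ x → toℕ x ≤ toℕ v) (sym (g′-off v≢)) (g-≤ v)
      g′-colour : ∀ v → f (lookup g′ v) ≡ f v
      g′-colour v with v FP.≟ s
      ... | yes refl = trans (cong f g′-s) fz
      ... | no v≢    = trans (cong f (g′-off v≢)) (g-colour v)

    restore : redirect o′ g s ≡ o
    restore = sym (orientation-⊆⇒≡ G {o} {redirect o′ g s} oriented
      (redirect-orientation {o′} {g} {s} (Cert.oriented cert′) ¬s) sub)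
      where
      sub : ∀ {u v} → arc o u v ≡ true → arc (redirect o′ g s) u v ≡ true
      sub {u} {v} a with u FP.≟ s | v FP.≟ s
      ... | yes refl | _ = redirected⇒arc (leaving (arc⇒adj a) (below (f v FP.≟ c₀)))
        where
        below : Dec (f v ≡ c₀) → f v ≡ c₀ ⊎ toℕ (lookup g v) < toℕ (lookup g s)
        below (yes e) = inj₁ e
        below (no ¬v) = inj₂ (ℕP.≤∧≢⇒< (g-mono a ¬v) (level a ¬v ∘ FP.toℕ-injective))
      ... | no u≢ | yes refl = redirected⇒arc (entering u≢ (arc⇒adj a) (λ e → sinks e a) (g-mono a ¬s))
      ... | no u≢ | no v≢    = redirected⇒arc (away u≢ v≢ (redirected⇒arc (away u≢ v≢ a)))

  -- The involution on orientations for an improper colouring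

  Mono : Fin n → Fin n → Set
  Mono x y = adj G x y ≡ true × f x ≡ f y × f x ≢ c₀

  mono-symm : ∀ {x y} → Mono x y → Mono y x
  mono-symm (a , e , ¬x) = adj-symm G a , sym e , λ e′ → ¬x (trans e e′)

  -- `v` is the lower of the two levels met by some monochromatic edge, possibly one inside a single
  -- level. Beyond the greatest such level no monochromatic edge remains.
  Key : Vec (Fin n) n → Fin n → Set
  Key g v = ∃ λ x → ∃ λ y → Mono x y × lookup g x ≡ v × toℕ v ≤ toℕ (lookup g y)

  key? : ∀ g → Decidable (Key g)
  key? g v = FP.any? λ x → FP.any? λ y →
    ((adj G x y Bool.≟ true) ×-dec (f x FP.≟ f y) ×-dec ¬? (f x FP.≟ c₀))
    ×-dec (lookup g x FP.≟ v) ×-dec (toℕ v ℕ.≤? toℕ (lookup g y))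

  Top : Vec (Fin n) n → Fin n → Set
  Top g v = Key g v × (∀ w → Key g w → toℕ w ≤ toℕ v)

  -- Inner and outer candidates are the non-isolated sinks other than v of the
  -- colour class of v restricted to levels ≥ v, when the edges between level v
  -- and the higher levels (an independent set if v is top) are directed upwards.
  Inner Outer Candidate : Orientation n → Vec (Fin n) n → Fin n → Fin n → Set
  Inner o g v s = lookup g s ≡ v × (∀ w → adj G s w ≡ true → f w ≡ f v →
    (lookup g w ≡ v → arc o w s ≡ true) × ¬ (toℕ v < toℕ (lookup g w)))
  Outer o g v s = toℕ v < toℕ (lookup g s) × ∃ λ w → adj G s w ≡ true × lookup g w ≡ v
  Candidate o g v s = s ≢ v × f s ≡ f v × (Inner o g v s ⊎ Outer o g v s)

  candidate? : ∀ o g v → Decidable (Candidate o g v)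
  candidate? o g v s = ¬? (s FP.≟ v) ×-dec (f s FP.≟ f v) ×-dec
    (((lookup g s FP.≟ v) ×-dec FP.all? λ w → (adj G s w Bool.≟ true) →-dec ((f w FP.≟ f v) →-dec
        (((lookup g w FP.≟ v) →-dec (arc o w s Bool.≟ true)) ×-dec ¬? (toℕ v ℕ.<? toℕ (lookup g w)))))
     ⊎-dec ((toℕ v ℕ.<? toℕ (lookup g s)) ×-dec
        FP.any? λ w → (adj G s w Bool.≟ true) ×-dec (lookup g w FP.≟ v)))

  -- The involution moves s from level v to a level of its own, or back.
  target : Vec (Fin n) n → Fin n → Fin n → Fin n
  target g v s = if does (lookup g s FP.≟ v) then s else v

  target-≡ : ∀ g {v s} → lookup g s ≡ v → target g v s ≡ s
  target-≡ g {v} {s} e = cong (λ b → if b then s else v) (dec-true (lookup g s FP.≟ v) e)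

  target-≢ : ∀ g {v s} → lookup g s ≢ v → target g v s ≡ v
  target-≢ g {v} {s} e = cong (λ b → if b then s else v) (dec-false (lookup g s FP.≟ v) e)

  module TopFacts {o : Orientation n} {g : Vec (Fin n) n} (C : Cert o g) {v : Fin n} (top : Top g v) where
    open Cert C

    g-top : lookup g v ≡ v
    g-top with proj₁ top
    ... | x , _ , _ , e , _ = subst (λ u → lookup g u ≡ u) e (g-idem x)

    ¬v : f v ≢ c₀
    ¬v with proj₁ top
    ... | x , _ , (_ , _ , ¬x) , e , _ = λ e′ → ¬x (trans (sym (g-colour x)) (trans (cong f e) e′))

    level⇒colour : ∀ {w} → lookup g w ≡ v → f w ≡ f v
    level⇒colour {w} e = trans (sym (g-colour w)) (cong f e)

    no-edge-above : ∀ {x y} → Mono x y → toℕ v < toℕ (lookup g x) → ¬ (toℕ v < toℕ (lookup g y))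
    no-edge-above {x} {y} m lx ly with ℕP.≤-total (toℕ (lookup g x)) (toℕ (lookup g y))
    ... | inj₁ l = ℕP.<⇒≱ lx (proj₂ top _ (x , y , m , refl , l))
    ... | inj₂ l = ℕP.<⇒≱ ly (proj₂ top _ (y , x , mono-symm m , refl , l))

    -- A vertex that does not lead its level has a predecessor on the same level, hence of the same
    -- colour, and the edge between them would be monochromatic above `v`.
    single-above : ∀ {x} → toℕ v < toℕ (lookup g x) → f x ≢ c₀ → lookup g x ≡ x
    single-above {x} l ¬x with lookup g x FP.≟ x
    ... | yes e = e
    ... | no ¬e with g-pred ¬e
    ...   | u , a , e = contradiction l (no-edge-above
              (arc⇒adj a , trans (sym (g-colour u)) (trans (cong f e) (g-colour x)) , λ e′ → sinks e′ a)
              (subst (λ z → toℕ v < toℕ z) (sym e) l))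

    -- If a monochromatic edge joins level `v` to a higher level, its upper end is an outer
    -- candidate. Otherwise the key edge lies inside level `v`, and following arcs within that level
    -- from its head ends at an inner candidate.
    candidate-exists : ∃ (Candidate o g v)
    candidate-exists with FP.any? (λ t → (f t FP.≟ f v) ×-dec (toℕ v ℕ.<? toℕ (lookup g t)) ×-dec
                            FP.any? (λ w → (adj G t w Bool.≟ true) ×-dec (lookup g w FP.≟ v)))
    ... | yes (t , e , l , w) = t , (λ { refl → ℕP.<-irrefl (cong toℕ (sym g-top)) l }) , e , inj₂ (l , w)
    ... | no ¬cross = start (proj₁ top)
      where
      walk : ∀ t → Acc (λ x y → o ⊢ y ⊏ x) t → lookup g t ≡ v →
        (∃ λ z → lookup g z ≡ v × arc o z t ≡ true) → ∃ (Candidate o g v)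
      walk t (acc rs) et (z , ez , a) with FP.any? (λ w → (arc o t w Bool.≟ true) ×-dec (lookup g w FP.≟ v))
      ... | yes (w , b , ew) = walk w (rs (w , b , here)) ew (t , et , b)
      ... | no stuck = t , t≢v , level⇒colour et , inj₁ (et , λ w b ew → into w b , above w b ew)
        where
        t≢v : t ≢ v
        -- The predecessor `z` lies on level `v` and is thus reachable from `v`, so an arc from `z`
        -- to `v` would close a cycle.
        t≢v refl = acyclic z t a (subst (λ x → Path o x z) ez (g-path z))
        into : ∀ w → adj G t w ≡ true → lookup g w ≡ v → arc o w t ≡ true
        into w b e with adj⇒arc b
        ... | inj₁ c = contradiction (w , c , e) stuck
        ... | inj₂ c = c
        above : ∀ w → adj G t w ≡ true → f w ≡ f v → ¬ (toℕ v < toℕ (lookup g w))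
        above w b ew l = ¬cross (w , ew , l , t , adj-symm G b , et)
      wf : ∀ t → Acc (λ x y → o ⊢ y ⊏ x) t
      wf = spo-noetherian (⊏-isStrictPartialOrder {o = o} acyclic)
      start : Key g v → ∃ (Candidate o g v)
      start (x , y , (a , e , _) , ex , l) with ℕP.m≤n⇒m<n∨m≡n l
      ... | inj₁ l′ = contradiction (y , trans (sym e) (level⇒colour ex) , l′ , x , adj-symm G a , ex) ¬cross
      ... | inj₂ l′ with adj⇒arc a
      ...   | inj₁ b = walk y (wf y) (sym (FP.toℕ-injective l′)) (x , ex , b)
      ...   | inj₂ b = walk x (wf x) ex (y , sym (FP.toℕ-injective l′) , b)

  module Toggle {o : Orientation n} {g : Vec (Fin n) n} (C : Cert o g) {v s : Fin n}
    (top : Top g v) (cand : Candidate o g v s) where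
    open Cert C
    open TopFacts C top

    private
      z : Fin n
      z = target g v s

      s≢v : s ≢ v
      s≢v = proj₁ cand

      fs : f s ≡ f v
      fs = proj₁ (proj₂ cand)

      ¬s : f s ≢ c₀
      ¬s e = ¬v (trans (sym fs) e)

      side : (Inner o g v s × z ≡ s) ⊎ (Outer o g v s × z ≡ v)
      side with proj₂ (proj₂ cand)
      ... | inj₁ i = inj₁ (i , target-≡ g (proj₁ i))
      ... | inj₂ u = inj₂ (u , target-≢ g (λ e → ℕP.<-irrefl (cong toℕ (sym e)) (proj₁ u)))

      single-s : Outer o g v s → lookup g s ≡ s
      single-s (l , _) = single-above l ¬s

      v≤s : toℕ v ≤ toℕ s
      v≤s with side
      ... | inj₁ ((e , _) , _) = subst (λ x → toℕ x ≤ toℕ s) e (g-≤ s)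
      ... | inj₂ ((l , _) , _) = ℕP.≤-trans (ℕP.<⇒≤ l) (g-≤ s)

      z≤s : toℕ z ≤ toℕ s
      z≤s with side
      ... | inj₁ (_ , e) = ℕP.≤-reflexive (cong toℕ e)
      ... | inj₂ (_ , e) = subst (λ x → toℕ x ≤ toℕ s) (sym e) v≤s

      fz : f z ≡ f s
      fz with side
      ... | inj₁ (_ , e) = cong f e
      ... | inj₂ (_ , e) = trans (cong f e) (sym fs)

      level : ∀ {y} → arc o s y ≡ true → f y ≢ c₀ → lookup g y ≢ lookup g s
      level {y} a ¬y e with side
      ... | inj₁ ((es , into) , _) =
              arc-asym a (proj₁ (into y (arc⇒adj a) (level⇒colour ey)) ey)
        where
        ey : lookup g y ≡ v
        ey = trans e es
      ... | inj₂ (u@(l , _) , _) = arc-irrefl (subst (λ x → arc o s x ≡ true) y≡s a)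
        where
        y≡s : y ≡ s
        y≡s = trans (sym (single-above (subst (λ x → toℕ v < toℕ x) (sym e) l) ¬y)) (trans e (single-s u))

      upd-s : lookup (g [ s ]≔ z) s ≡ z
      upd-s = VP.lookup∘update s g z

      upd-off : ∀ {x} → x ≢ s → lookup (g [ s ]≔ z) x ≡ lookup g x
      upd-off x≢ = VP.lookup∘update′ x≢ g z

      -- No other vertex has `s` as its level, so a new value of `g` at `s` leaves `g` idempotent:
      -- an inner `s` does not lead a level, and an outer one is alone on its level.
      g≢s : ∀ {x} → x ≢ s → lookup g x ≢ s
      g≢s {x} x≢ e with side
      ... | inj₁ ((es , _) , _) = s≢v (trans (sym (trans (cong (lookup g) (sym e)) (trans (g-idem x) e))) es)
      ... | inj₂ (u@(l , _) , _) = x≢ (trans (sym (single-above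
              (subst (λ y → toℕ v < toℕ y) (trans (single-s u) (sym e)) l) ¬x)) e)
        where
        ¬x : f x ≢ c₀
        ¬x e′ = ¬s (trans (cong f (sym e)) (trans (g-colour x) e′))

      idem : ∀ x → lookup (g [ s ]≔ z) (lookup (g [ s ]≔ z) x) ≡ lookup (g [ s ]≔ z) x
      idem x with x FP.≟ s
      ... | no x≢ = trans (cong (lookup (g [ s ]≔ z)) (upd-off x≢))
              (trans (upd-off (g≢s x≢)) (trans (g-idem x) (sym (upd-off x≢))))
      ... | yes refl = trans (cong (lookup (g [ s ]≔ z)) upd-s) (trans fixed (sym upd-s))
        where
        fixed : lookup (g [ s ]≔ z) z ≡ z
        fixed with side
        ... | inj₁ (_ , e) = trans (cong (lookup (g [ s ]≔ z)) e) upd-s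
        ... | inj₂ (_ , e) = trans (cong (lookup (g [ s ]≔ z)) e) (trans (upd-off (s≢v ∘ sym)) (trans g-top (sym e)))

      pred : z ≢ s → ∃ λ u → u ≢ s × adj G u s ≡ true × f u ≢ c₀ × lookup g u ≡ z
      pred z≢ with side
      ... | inj₁ (_ , e) = contradiction e z≢
      ... | inj₂ ((l , w , a , ew) , e) = w , (λ { refl → ℕP.<-irrefl (cong toℕ (sym ew)) l }) , adj-symm G a
              , (λ e′ → ¬v (trans (sym (level⇒colour ew)) e′)) , trans ew (sym e)

    open Redirect C s z ¬s z≤s fz level idem pred public

    private
      above-off : ∀ {x} → x ≢ s → toℕ v < toℕ (lookup g′ x) → toℕ v < toℕ (lookup g x)
      above-off x≢ = subst (λ y → toℕ v < toℕ y) (g′-off x≢)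

      no-mono-above : ∀ {x y} → Mono x y → toℕ v < toℕ (lookup g′ x) → ¬ (toℕ v < toℕ (lookup g′ y))
      no-mono-above {x} {y} m@(a , e , ¬x) lx ly with x FP.≟ s | y FP.≟ s
      ... | yes refl | yes refl = true≢false a (adj-irrefl G s)
      ... | no x≢    | no y≢    = no-edge-above m (above-off x≢ lx) (above-off y≢ ly)
      ... | yes refl | no y≢ with side
      ...   | inj₁ ((_ , into) , _) = proj₂ (into y a (trans (sym e) fs)) (above-off y≢ ly)
      ...   | inj₂ (_ , e′) = ℕP.<-irrefl (cong toℕ (sym (trans g′-s e′))) lx
      no-mono-above {x} {y} m@(a , e , ¬x) lx ly | no x≢ | yes refl with side
      ...   | inj₁ ((_ , into) , _) = proj₂ (into x (adj-symm G a) (trans e fs)) (above-off x≢ lx)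
      ...   | inj₂ (_ , e′) = ℕP.<-irrefl (cong toℕ (sym (trans g′-s e′))) ly

      inner-pred : Inner o g v s → ∃ λ u → u ≢ s × adj G u s ≡ true × lookup g u ≡ v
      inner-pred (es , _) with g-pred {s} (λ e → s≢v (trans (sym e) es))
      ... | u , a , e = u , (λ { refl → arc-irrefl a }) , arc⇒adj a , trans e es

    -- No monochromatic edge arises above `v`: an inner `s` has no neighbour of its colour there,
    -- and an outer `s` descends to level `v`. The level `v` remains a key through an edge between
    -- `s` and a neighbour on level `v`.
    top′ : Top g′ v
    top′ = key′ , λ w → λ { (x , y , m , refl , l) → ℕP.≮⇒≥ λ v<w →
             no-mono-above m v<w (ℕP.<-≤-trans v<w l) }
      where
      key′ : Key g′ v
      key′ with side
      ... | inj₁ (i , e) with inner-pred i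
      ...   | u , u≢ , a , eu = u , s , (a , trans (level⇒colour eu) (sym fs) , λ e′ → ¬v (trans (sym (level⇒colour eu)) e′))
                , trans (g′-off u≢) eu , subst (λ y → toℕ v ≤ toℕ y) (sym (trans g′-s e)) v≤s
      key′ | inj₂ ((l , w , a , ew) , e) =
              s , w , (a , trans fs (sym (level⇒colour ew)) , ¬s) , trans g′-s e
              , ℕP.≤-reflexive (cong toℕ (sym (trans (g′-off w≢) ew)))
        where
        w≢ : w ≢ s
        w≢ refl = ℕP.<-irrefl (cong toℕ (sym ew)) l

    -- Candidates are pairwise non-adjacent, so moving `s` leaves the conditions on any other
    -- candidate intact, while `s` itself passes from inner to outer or back.
    cand′ : ∀ {t} → Candidate o g v t → Candidate o′ g′ v t
    cand′ {t} (t≢v , ft , c) = t≢v , ft , new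
      where
      new : Inner o′ g′ v t ⊎ Outer o′ g′ v t
      other : t ≢ s → Inner o g v t ⊎ Outer o g v t → Inner o′ g′ v t ⊎ Outer o′ g′ v t
      new with t FP.≟ s
      new | yes refl with side
      ... | inj₁ (i , e) with inner-pred i
      ...   | u , u≢ , a , eu = inj₂ (ℕP.≤∧≢⇒< (subst (λ y → toℕ v ≤ toℕ y) (sym (trans g′-s e)) v≤s)
                  (λ e′ → s≢v (sym (trans (FP.toℕ-injective e′) (trans g′-s e))))
                , u , adj-symm G a , trans (g′-off u≢) eu)
      new | yes refl | inj₂ (u@(l , w , a , ew) , e) = inj₁ (trans g′-s e , λ x b ex → into x b , above x b ex)
        where
        off : ∀ {x} → adj G s x ≡ true → x ≢ s
        off b refl = true≢false b (adj-irrefl G s)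
        into : ∀ x → adj G s x ≡ true → lookup g′ x ≡ v → arc o′ x s ≡ true
        into x b e′ = redirected⇒arc (entering (off b) (adj-symm G b)
          (λ e″ → ¬v (trans (sym (level⇒colour (trans (sym (g′-off (off b))) e′))) e″))
          (ℕP.≤-reflexive (cong toℕ (trans g′-s (trans e (sym e′))))))
        above : ∀ x → adj G s x ≡ true → f x ≡ f v → ¬ (toℕ v < toℕ (lookup g′ x))
        above x b ex l′ = no-edge-above (b , trans fs (sym ex) , ¬s) l (above-off (off b) l′)
      new | no t≢ = other t≢ c
      other t≢ (inj₁ (et , into)) = inj₁ (trans (g′-off t≢) et , into′)
        where
        into′ : ∀ w → adj G t w ≡ true → f w ≡ f v →
          (lookup g′ w ≡ v → arc o′ w t ≡ true) × ¬ (toℕ v < toℕ (lookup g′ w))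
        into′ w b ew with w FP.≟ s
        ... | no w≢ = (λ e → redirected⇒arc (away w≢ t≢ (proj₁ (into w b ew) (trans (sym (g′-off w≢)) e))))
                    , (λ l → proj₂ (into w b ew) (above-off w≢ l))
        ... | yes refl with side
        ...   | inj₁ ((es , into-s) , _) = contradiction (proj₁ (into-s t (adj-symm G b) ft) et)
                  (arc-asym (proj₁ (into s b ew) es))
        ...   | inj₂ ((l , _) , _) = contradiction l (proj₂ (into s b ew))
      other t≢ (inj₂ (l , w , a , ew)) = inj₂ (subst (λ y → toℕ v < toℕ y) (sym (g′-off t≢)) l
                                         , w , a , trans (g′-off w≢) ew)
        where
        w≢ : w ≢ s
        w≢ refl with side
        ... | inj₁ ((_ , into) , _) = proj₂ (into t (adj-symm G a) ft) l
        ... | inj₂ ((l′ , _) , _) = ℕP.<-irrefl (cong toℕ (sym ew)) l′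

    -- Exactly one of `g` and `g′` fixes `s`, which is what reverses the sign.
    g-or-g′ : (lookup g s ≢ s × z ≡ s) ⊎ (lookup g s ≡ s × z ≢ s)
    g-or-g′ with side
    ... | inj₁ ((es , _) , e) = inj₁ ((λ e′ → s≢v (trans (sym e′) es)) , e)
    ... | inj₂ (u , e)        = inj₂ (single-s u , λ e′ → s≢v (trans (sym e′) e))

    target′ : g′ [ s ]≔ target g′ v s ≡ g
    target′ = trans (VP.[]≔-idempotent g s) (trans (cong (g [ s ]≔_) back) (VP.[]≔-lookup g s))
      where
      back : target g′ v s ≡ lookup g s
      back with side
      ... | inj₁ ((es , _) , e) = trans (target-≢ g′ (λ e′ → s≢v (trans (sym (trans g′-s e)) e′))) (sym es)
      ... | inj₂ (u , e)        = trans (target-≡ g′ (trans g′-s e)) (sym (single-s u))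

  abstract
    weight : Orientation n → ℤ
    weight o = ⟦ valid? o ⟧ * signs (ext (fixes (lead o))) n

    weight-valid : ∀ {o} → Valid o → weight o ≡ signs (ext (fixes (lead o))) n
    weight-valid {o} V = trans (cong (_* signs (ext (fixes (lead o))) n) (⟦⟧-yes (valid? o) V)) (ℤP.*-identityˡ _)

    weight-invalid : ∀ {o} → ¬ Valid o → weight o ≡ 0ℤ
    weight-invalid {o} ¬V = cong (_* signs (ext (fixes (lead o))) n) (⟦⟧-no (valid? o) ¬V)

  Proper : Set
  Proper = ∀ u v → adj G u v ≡ true → f u ≢ f v

  proper? : Dec Proper
  proper? = FP.all? λ u → FP.all? λ v → (adj G u v Bool.≟ true) →-dec ¬? (f u FP.≟ f v)

  private
    First : Orientation n → Vec (Fin n) n → Fin n → Fin n → Set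
    First o g v s = Candidate o g v s × (∀ t → Candidate o g v t → toℕ s ≤ toℕ t)

    flipped : Orientation n → Fin n → Fin n → Orientation n
    flipped o v s = redirect o (lead o [ s ]≔ target (lead o) v s) s

    -- Everything is recorded for both orientations, so symmetry is an exchange of fields. As the
    -- greatest key and its least candidate, `v` and `s` depend on `o` alone, which makes the
    -- relation functional.
    record Flip (o o′ : Orientation n) : Set where
      field
        v s    : Fin n
        top    : Top (lead o) v
        top′   : Top (lead o′) v
        first  : First o (lead o) v s
        first′ : First o′ (lead o′) v s
        eq     : o′ ≡ flipped o v s
        eq′    : o ≡ flipped o′ v s
        neg    : weight o′ ≡ - weight o

    Flip-sym : ∀ {o o′} → Flip o o′ → Flip o′ o
    Flip-sym F = record
      { v = v ; s = s ; top = top′ ; top′ = top ; first = first′ ; first′ = first ; eq = eq′ ; eq′ = eq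
      ; neg = trans (sym (ℤP.neg-involutive _)) (cong -_ (sym neg)) }
      where open Flip F

    Flip-functional : ∀ {o o₁ o₂} → Flip o o₁ → Flip o o₂ → o₁ ≡ o₂
    Flip-functional {o} F F′ with
      FP.toℕ-injective (ℕP.≤-antisym (proj₂ (Flip.top F′) _ (proj₁ (Flip.top F)))
                                     (proj₂ (Flip.top F) _ (proj₁ (Flip.top F′))))
    ... | e = trans (Flip.eq F) (trans (cong₂ (flipped o) e same-s) (sym (Flip.eq F′)))
      where
      same-s : Flip.s F ≡ Flip.s F′
      same-s = FP.toℕ-injective (ℕP.≤-antisym
        (proj₂ (Flip.first F) _ (subst (λ x → Candidate o (lead o) x (Flip.s F′)) (sym e) (proj₁ (Flip.first F′))))
        (proj₂ (Flip.first F′) _ (subst (λ x → Candidate o (lead o) x (Flip.s F)) e (proj₁ (Flip.first F)))))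

    key-exists : ∀ {o g} → Cert o g → ¬ Proper → ∃ (Key g)
    key-exists {o} {g} C ¬proper with FP.any? (λ x → FP.any? (λ y → (adj G x y Bool.≟ true) ×-dec (f x FP.≟ f y)))
    ... | no ¬ex = contradiction (λ u v a e → ¬ex (u , v , a , e)) ¬proper
    ... | yes (x , y , a , e) with ℕP.≤-total (toℕ (lookup g x)) (toℕ (lookup g y))
    ...   | inj₁ l = lookup g x , x , y , (a , e , ¬x) , refl , l
      where
      ¬x : f x ≢ c₀
      -- An edge inside the singled-out class would give one of its sinks an outgoing arc.
      ¬x ex = case Cert.adj⇒arc C a of λ { (inj₁ b) → Cert.sinks C ex b ; (inj₂ b) → Cert.sinks C (trans (sym e) ex) b }
    ...   | inj₂ l = lookup g y , y , x , mono-symm (a , e , ¬x) , refl , l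
      where
      ¬x : f x ≢ c₀
      ¬x ex = case Cert.adj⇒arc C a of λ { (inj₁ b) → Cert.sinks C ex b ; (inj₂ b) → Cert.sinks C (trans (sym e) ex) b }

    flip-at : ∀ {o} → Valid o → ∀ v s → Top (lead o) v → First o (lead o) v s → ∃ (Flip o)
    flip-at {o} V v s top first = o′ , record
      { v = v ; s = s ; top = top ; top′ = subst (λ h → Top h v) (sym lead′) top′
      ; first = first ; first′ = subst (λ h → First o′ h v s) (sym lead′) (cand′ (proj₁ first) , first′)
      ; eq = refl
      ; eq′ = sym (trans (cong (λ h → redirect o′ (h [ s ]≔ target h v s) s) lead′)
                         (trans (cong (λ h → redirect o′ h s) target′) restore))
      ; neg = trans (weight-valid (Cert.cert⇒valid cert′)) (trans (cong (λ h → signs (ext (fixes h)) n) lead′)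
                (trans (signs-ext-flip (fixes g′) (fixes g) s
                          (λ {x} x≢ → cong (λ y → does (y FP.≟ x)) (g′-off x≢)) flip-s)
                       (cong -_ (sym (weight-valid V))))) }
      where
      g : Vec (Fin n) n
      g = lead o
      C : Cert o g
      C = valid⇒cert V
      open Toggle C top (proj₁ first)
      lead′ : lead o′ ≡ g′
      lead′ = Cert.cert⇒lead cert′
      first′ : ∀ t → Candidate o′ g′ v t → toℕ s ≤ toℕ t
      -- Toggling back turns a candidate of the new orientation into one of the old, so minimality
      -- of `s` carries over.
      first′ t c = proj₂ first t (subst (λ x → Candidate x g v t) restore
        (subst (λ h → Candidate (redirect o′ h s) h v t) target′
          (Toggle.cand′ cert′ top′ (cand′ (proj₁ first)) c)))
      flip-s : fixes g′ s ≡ not (fixes g s)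
      flip-s with g-or-g′
      ... | inj₁ (¬e , e) = trans (dec-true (lookup g′ s FP.≟ s) (trans g′-s e))
                                  (cong not (sym (dec-false (lookup g s FP.≟ s) ¬e)))
      ... | inj₂ (e , ¬e) = trans (dec-false (lookup g′ s FP.≟ s) (λ e′ → ¬e (trans (sym g′-s) e′)))
                                  (cong not (sym (dec-true (lookup g s FP.≟ s) e)))

    flip-exists : ¬ Proper → ∀ {o} → Valid o → ∃ (Flip o)
    flip-exists ¬proper {o} V =
      let v , top   = greatest (key? (lead o)) (key-exists (valid⇒cert V) ¬proper)
          s , first = least (candidate? o (lead o) v) (TopFacts.candidate-exists (valid⇒cert V) top)
      in flip-at V v s top first

  ∑-weight-improper : ¬ Proper → ∑ (orientations n) weight ≡ 0ℤ
  ∑-weight-improper ¬proper = ∑-involution (finiteVec (finiteVec finiteBool n) n) Flip weight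
    Flip-sym Flip-functional Flip.neg
    (λ o w≢0 → case valid? o of λ where
      (yes V) → flip-exists ¬proper V
      (no ¬V) → contradiction (weight-invalid ¬V) w≢0)

  -- The only valid orientation for a proper colouring

  private
    -- For proper `f` each vertex is its own level, since an arc within a level outside the
    -- singled-out class would be monochromatic. Monotonicity of levels then forces every arc: into
    -- the singled-out class, and otherwise from the larger to the smaller label.
    data Downhill : Fin n → Fin n → Set where
      downhill : ∀ {x y} → adj G x y ≡ true → f x ≢ c₀ → f y ≡ c₀ ⊎ toℕ y < toℕ x → Downhill x y

    downhill? : ∀ x y → Dec (Downhill x y)
    downhill? x y = map′ (λ { (a , b , c) → downhill a b c }) (λ { (downhill a b c) → a , b , c })
      ((adj G x y Bool.≟ true) ×-dec ¬? (f x FP.≟ c₀) ×-dec ((f y FP.≟ c₀) ⊎-dec (toℕ y ℕ.<? toℕ x)))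

    o₀ : Orientation n
    o₀ = matrix λ x y → does (downhill? x y)

    arc⇒downhill : ∀ {x y} → arc o₀ x y ≡ true → Downhill x y
    arc⇒downhill {x} {y} a = does-≡true (downhill? x y) (trans (sym (arc-matrix _ x y)) a)

    downhill⇒arc : ∀ {x y} → Downhill x y → arc o₀ x y ≡ true
    downhill⇒arc {x} {y} d = trans (arc-matrix _ x y) (dec-true (downhill? x y) d)

    lookup-id : ∀ v → lookup (Vec.allFin n) v ≡ v
    lookup-id = VP.lookup∘tabulate id

    o₀-orientation : Proper → IsOrientation G o₀
    o₀-orientation proper = mkOrientation G {o₀} ⊆adj asym total
      where
      ⊆adj : ∀ {u v} → arc o₀ u v ≡ true → adj G u v ≡ true
      ⊆adj {u} {v} a with arc⇒downhill {u} {v} a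
      ... | downhill b _ _ = b
      asym : ∀ {u v} → arc o₀ u v ≡ true → arc o₀ v u ≢ true
      asym {u} {v} a b with arc⇒downhill {u} {v} a | arc⇒downhill {v} {u} b
      ... | downhill _ _ (inj₁ e) | downhill _ ¬e _       = ¬e e
      ... | downhill _ ¬e _       | downhill _ _ (inj₁ e) = ¬e e
      ... | downhill _ _ (inj₂ l) | downhill _ _ (inj₂ m) = ℕP.<-asym l m
      total : ∀ {u v} → adj G u v ≡ true → arc o₀ u v ≡ true ⊎ arc o₀ v u ≡ true
      total {u} {v} a with f u FP.≟ c₀ | f v FP.≟ c₀ | ℕP.<-cmp (toℕ u) (toℕ v)
      ... | yes eu | yes ev | _ = contradiction (trans eu (sym ev)) (proper u v a)
      ... | yes eu | no ¬v | _ = inj₂ (downhill⇒arc (downhill (adj-symm G a) ¬v (inj₁ eu)))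
      ... | no ¬u | yes ev | _ = inj₁ (downhill⇒arc (downhill a ¬u (inj₁ ev)))
      ... | no ¬u | no ¬v | tri< l _ _ = inj₂ (downhill⇒arc (downhill (adj-symm G a) ¬v (inj₂ l)))
      ... | no ¬u | no ¬v | tri≈ _ e _ = contradiction (cong f (FP.toℕ-injective e)) (proper u v a)
      ... | no ¬u | no ¬v | tri> _ _ l = inj₁ (downhill⇒arc (downhill a ¬u (inj₂ l)))

    o₀-cert : Proper → Cert o₀ (Vec.allFin n)
    o₀-cert proper = record
      { oriented = o₀-orientation proper
      ; acyclic  = λ u v a p → acyclic′ a p
      ; sinks    = sinks′
      ; g-c₀     = λ {v} _ → lookup-id v
      ; g-mono   = λ {u} {v} a ¬v → subst (λ (x , y) → toℕ x ≤ toℕ y)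
                     (cong₂ _,_ (sym (lookup-id v)) (sym (lookup-id u))) (ℕP.<⇒≤ (descend a ¬v))
      ; g-≤      = λ v → ℕP.≤-reflexive (cong toℕ (lookup-id v))
      ; g-idem   = λ v → lookup-id _
      ; g-colour = λ v → cong f (lookup-id v)
      ; g-pred   = λ {v} ¬e → contradiction (lookup-id v) ¬e }
      where
      sinks′ : ∀ {v u} → f v ≡ c₀ → arc o₀ v u ≢ true
      sinks′ {v} {u} e a with arc⇒downhill {v} {u} a
      ... | downhill _ ¬e _ = ¬e e
      descend : ∀ {u v} → arc o₀ u v ≡ true → f v ≢ c₀ → toℕ v < toℕ u
      descend {u} {v} a ¬v with arc⇒downhill {u} {v} a
      ... | downhill _ _ (inj₁ e) = contradiction e ¬v
      ... | downhill _ _ (inj₂ l) = l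
      path-descend : ∀ {u v} → Path o₀ u v → f v ≢ c₀ → f u ≢ c₀ × toℕ v ≤ toℕ u
      path-descend here       ¬v = ¬v , ℕP.≤-refl
      path-descend (step a p) ¬v = let ¬w , l = path-descend p ¬v in
        (λ e → sinks′ e a) , ℕP.≤-trans l (ℕP.<⇒≤ (descend a ¬w))
      acyclic′ : ∀ {u v} → arc o₀ u v ≡ true → ¬ Path o₀ v u
      acyclic′ {u} {v} a p = let ¬v , l = path-descend p (λ e → sinks′ {u} {v} e a) in ℕP.<⇒≱ (descend a ¬v) l

    valid⇒≡o₀ : Proper → ∀ {o} → Valid o → o ≡ o₀
    valid⇒≡o₀ proper {o} V = orientation-⊆⇒≡ G {o} {o₀} oriented (o₀-orientation proper) sub
      where
      open Cert (valid⇒cert V)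
      fixed : ∀ v → lookup (lead o) v ≡ v
      fixed v with lookup (lead o) v FP.≟ v
      ... | yes e = e
      ... | no ¬e with g-pred ¬e
      ...   | u , a , e = contradiction (trans (sym (g-colour u)) (trans (cong f e) (g-colour v))) (proper u v (arc⇒adj a))
      sub : ∀ {u v} → arc o u v ≡ true → arc o₀ u v ≡ true
      sub {u} {v} a = downhill⇒arc (downhill (arc⇒adj a) (λ e → sinks e a) (below (f v FP.≟ c₀)))
        where
        below : Dec (f v ≡ c₀) → f v ≡ c₀ ⊎ toℕ v < toℕ u
        below (yes e) = inj₁ e
        below (no ¬v) = inj₂ (ℕP.≤∧≢⇒< (subst (λ (x , y) → toℕ x ≤ toℕ y) (cong₂ _,_ (fixed v) (fixed u)) (g-mono a ¬v))
          (λ e → arc-irrefl (subst (λ x → arc o x v ≡ true) (sym (FP.toℕ-injective e)) a)))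

    signs-true : ∀ b j → (∀ {i} → i < j → b i ≡ true) → signs b j ≡ 1ℤ
    signs-true b zero    e = refl
    signs-true b (suc j) e = trans (cong₂ (λ x y → (if x then 1ℤ else -1ℤ) * y) (e ℕP.≤-refl)
      (signs-true b j (λ l → e (ℕP.m<n⇒m<1+n l)))) refl

  ∑-weight-proper : Proper → ∑ (orientations n) weight ≡ 1ℤ
  ∑-weight-proper proper = trans (∑-δ (finiteVec (finiteVec finiteBool n) n) o₀ off)
    (trans (weight-valid (Cert.cert⇒valid C)) (trans (cong (λ h → signs (ext (fixes h)) n) (Cert.cert⇒lead C))
      (signs-true _ n λ {i} i<n → subst (λ j → ext (fixes (Vec.allFin n)) j ≡ true) (FP.toℕ-fromℕ< i<n)
        (trans (ext-toℕ (fixes (Vec.allFin n)) (fromℕ< i<n)) (dec-true (_ FP.≟ _) (lookup-id _))))))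
    where
    C : Cert o₀ (Vec.allFin n)
    C = o₀-cert proper
    off : ∀ o → o ≢ o₀ → weight o ≡ 0ℤ
    off o o≢ = weight-invalid (λ V → o≢ (valid⇒≡o₀ proper V))

  ∑-weight : ∑ (orientations n) weight ≡ ⟦ proper? ⟧
  ∑-weight = case proper? of λ where
    (yes p) → trans (∑-weight-proper p) (sym (⟦⟧-yes proper? p))
    (no ¬p) → trans (∑-weight-improper ¬p) (sym (⟦⟧-no proper? ¬p))

-- The signed sum over colourings for a fixed orientation

-- Junk value: positions out of range give zero.
at : ∀ {m j} → Vec (Fin (suc m)) j → ℕ → Fin (suc m)
at []       _       = Fin.zero
at (x ∷ _)  zero    = x
at (_ ∷ xs) (suc i) = at xs i

at-lookup : ∀ {m j} (xs : Vec (Fin (suc m)) j) v → at xs (toℕ v) ≡ lookup xs v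
at-lookup (x ∷ _)  Fin.zero    = refl
at-lookup (_ ∷ xs) (Fin.suc v) = at-lookup xs v

at-last : ∀ {m j} (xs : Vec (Fin (suc m)) j) x → at (xs ∷ʳ x) j ≡ x
at-last []       x = refl
at-last (_ ∷ xs) x = at-last xs x

at-init : ∀ {m j} (xs : Vec (Fin (suc m)) j) x {i} → i < j → at (xs ∷ʳ x) i ≡ at xs i
at-init (_ ∷ _)  x {zero}  _       = refl
at-init (_ ∷ xs) x {suc i} (s≤s l) = at-init xs x l

colourings : ∀ m n → List (Vec (Fin (suc m)) n)
colourings m n = Finite.elements (finiteVec (finiteFin (suc m)) n)

∑-1 : {A : Set} (xs : List A) → ∑ xs (λ _ → 1ℤ) ≡ + length xs
∑-1 []       = refl
∑-1 (x ∷ xs) = cong (λ z → 1ℤ + z) (∑-1 xs)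

allBelow? : {P : ℕ → Set} → Decidable P → ∀ v → Dec (∀ i → i < v → P i)
allBelow? P? v = map′ (λ p i → p {i}) (λ p {i} → p i) (ℕP.allUpTo? P? v)

-- L i plays the role of the leader of i, and b i says whether i is a leader.
module Counting (m n d : ℕ) (1≤d : 1 ≤ d) (b : ℕ → Bool) (L : ℕ → ℕ)
  (b-true : ∀ {i} → i < n → b i ≡ true → L i ≡ i)
  (b-false : ∀ {i} → i < n → b i ≡ false → 0 < L i × L i < i)
  (b-d : ∀ {i} → i < d → b i ≡ true) where

  -- As `L i` is at most `i`, the condition at `i` looks only at labels up to `i`. Appending a
  -- colour therefore adds one condition and leaves the earlier ones unchanged.
  Admissible : ∀ {j} → Vec (Fin (suc m)) j → ℕ → Set
  Admissible xs i = at xs (L i) ≡ at xs i × (0 < i → at xs 0 ≢ at xs i)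
    × (i < d → ∀ i′ → i′ < i → at xs i′ ≢ at xs i)

  admissible? : ∀ {j} (xs : Vec (Fin (suc m)) j) → Decidable (Admissible xs)
  admissible? xs i = (at xs (L i) FP.≟ at xs i) ×-dec ((0 ℕ.<? i) →-dec ¬? (at xs 0 FP.≟ at xs i))
    ×-dec ((i ℕ.<? d) →-dec allBelow? (λ i′ → ¬? (at xs i′ FP.≟ at xs i)) i)

  Ok : ∀ {j} → Vec (Fin (suc m)) j → Set
  Ok {j} xs = ∀ i → i < j → Admissible xs i

  ok? : ∀ {j} (xs : Vec (Fin (suc m)) j) → Dec (Ok xs)
  ok? {j} xs = allBelow? (admissible? xs) j

  -- The number of colours free for label `j`: one for a non-leader, which copies `L j`; for a
  -- leader all but the `j` earlier colours if `j < d`, and all but the colour of label 0 otherwise.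
  factor : ℕ → ℤ
  factor j = if b j then (if does (j ℕ.<? d) then + suc m - + j else + m) else 1ℤ

  total : ℕ → ℤ
  total zero    = 1ℤ
  total (suc j) = factor j * total j

  L≤ : ∀ {i} → i < n → L i ≤ i
  L≤ {i} i<n with b i in e
  ... | true  = ℕP.≤-reflexive (b-true i<n e)
  ... | false = ℕP.<⇒≤ (proj₂ (b-false i<n e))

  private
    admissible-init : ∀ {j} (xs : Vec (Fin (suc m)) j) x {i} → i < j → j ≤ n →
      Admissible (xs ∷ʳ x) i ⇔ Admissible xs i
    admissible-init {j} xs x {i} i<j j≤n = mk⇔
      (λ (p , q , r) → trans (sym (init L<)) (trans p (init i<j))
        , (λ 0<i e → q 0<i (trans (init (ℕP.<-trans 0<i i<j)) (trans e (sym (init i<j)))))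
        , (λ i<d i′ i′<i e → r i<d i′ i′<i (trans (init (ℕP.<-trans i′<i i<j)) (trans e (sym (init i<j))))))
      (λ (p , q , r) → trans (init L<) (trans p (sym (init i<j)))
        , (λ 0<i e → q 0<i (trans (sym (init (ℕP.<-trans 0<i i<j))) (trans e (init i<j))))
        , (λ i<d i′ i′<i e → r i<d i′ i′<i (trans (sym (init (ℕP.<-trans i′<i i<j))) (trans e (init i<j)))))
      where
      init : ∀ {i} → i < j → at (xs ∷ʳ x) i ≡ at xs i
      init = at-init xs x
      L< : L i < j
      L< = ℕP.≤-<-trans (L≤ (ℕP.<-≤-trans i<j j≤n)) i<j

    ok-snoc : ∀ {j} (xs : Vec (Fin (suc m)) j) x → suc j ≤ n →
      Ok (xs ∷ʳ x) ⇔ (Ok xs × Admissible (xs ∷ʳ x) j)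
    ok-snoc {j} xs x j<n = mk⇔
      (λ ok → (λ i i<j → Equivalence.to (admissible-init xs x i<j (ℕP.<⇒≤ j<n)) (ok i (ℕP.m<n⇒m<1+n i<j))) , ok j ℕP.≤-refl)
      (λ (ok , new) i i<1+j → case ℕP.m≤n⇒m<n∨m≡n (ℕP.≤-pred i<1+j) of λ where
        (inj₁ i<j)  → Equivalence.from (admissible-init xs x i<j (ℕP.<⇒≤ j<n)) (ok i i<j)
        (inj₂ refl) → new)

    avoid? : ∀ {j} (xs : Vec (Fin (suc m)) j) t x → Dec (∀ i → i < t → at xs i ≢ x)
    avoid? xs t x = allBelow? (λ i → ¬? (at xs i FP.≟ x)) t

    F : Finite (Fin (suc m))
    F = finiteFin (suc m)

    -- The prescribed colours are distinct, so each further position excludes exactly one colour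
    -- that was still free.
    ∑-avoid : ∀ {j} (xs : Vec (Fin (suc m)) j) t → (∀ i → i < t → ∀ i′ → i′ < i → at xs i′ ≢ at xs i) →
      ∑ (List.allFin (suc m)) (λ x → ⟦ avoid? xs t x ⟧) ≡ + suc m - + t
    ∑-avoid xs zero    inj = begin
      ∑ (List.allFin (suc m)) (λ x → ⟦ avoid? xs 0 x ⟧)
        ≡⟨ ∑-cong (List.allFin (suc m)) (λ x → ⟦⟧-yes (avoid? xs 0 x) (λ _ ())) ⟩
      ∑ (List.allFin (suc m)) (λ _ → 1ℤ)
        ≡⟨ ∑-1 (List.allFin (suc m)) ⟩
      + length (List.allFin (suc m))
        ≡⟨ cong +_ (LP.length-tabulate {n = suc m} id) ⟩
      + suc m
        ≡⟨ sym (ℤP.+-identityʳ _) ⟩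
      + suc m - + 0 ∎
      where open ≡-Reasoning
    ∑-avoid xs (suc t) inj = begin
      ∑ all (λ x → ⟦ avoid? xs (suc t) x ⟧)
        ≡⟨ ∑-cong all split ⟩
      ∑ all (λ x → ⟦ avoid? xs t x ⟧ + - ⟦ x FP.≟ at xs t ⟧)
        ≡⟨ ∑-+ all (λ x → ⟦ avoid? xs t x ⟧) (λ x → - ⟦ x FP.≟ at xs t ⟧) ⟩
      ∑ all (λ x → ⟦ avoid? xs t x ⟧) + ∑ all (λ x → - ⟦ x FP.≟ at xs t ⟧)
        ≡⟨ cong₂ _+_ (∑-avoid xs t (λ i i<t → inj i (ℕP.m<n⇒m<1+n i<t)))
                     (trans (∑-δ F (at xs t) (λ x x≢ → cong -_ (⟦⟧-no (x FP.≟ at xs t) x≢)))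
                            (cong -_ (⟦⟧-yes (at xs t FP.≟ at xs t) refl))) ⟩
      (+ suc m - + t) + - 1ℤ
        ≡⟨ arith (+ suc m) (+ t) ⟩
      + suc m - + suc t ∎
      where
      open ≡-Reasoning
      all : List (Fin (suc m))
      all = List.allFin (suc m)
      arith : ∀ a c → (a - c) + - 1ℤ ≡ a - (1ℤ + c)
      arith = solve-∀
      split : ∀ x → ⟦ avoid? xs (suc t) x ⟧ ≡ ⟦ avoid? xs t x ⟧ + - ⟦ x FP.≟ at xs t ⟧
      split x with x FP.≟ at xs t
      ... | yes refl = trans (⟦⟧-no (avoid? xs (suc t) (at xs t)) (λ a → a t ℕP.≤-refl refl))
                             (sym (cong (λ z → z + - 1ℤ) (⟦⟧-yes (avoid? xs t (at xs t)) (inj t ℕP.≤-refl))))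
      ... | no x≢ = trans (⟦⟧-cong (avoid? xs (suc t) x) (avoid? xs t x)
                             (λ a i i<t → a i (ℕP.m<n⇒m<1+n i<t))
                             (λ a i i<1+t → case ℕP.m≤n⇒m<n∨m≡n (ℕP.≤-pred i<1+t) of λ where
                                (inj₁ i<t)  → a i i<t
                                (inj₂ refl) → x≢ ∘ sym))
                          (sym (ℤP.+-identityʳ _))

    factor-true : ∀ {j} → b j ≡ true → factor j ≡ (if does (j ℕ.<? d) then + suc m - + j else + m)
    factor-true {j} e = cong (λ x → if x then (if does (j ℕ.<? d) then + suc m - + j else + m) else 1ℤ) e

    factor-false : ∀ {j} → b j ≡ false → factor j ≡ 1ℤ
    factor-false {j} e = cong (λ x → if x then (if does (j ℕ.<? d) then + suc m - + j else + m) else 1ℤ) e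

    factor-< : ∀ {j} → j < d → factor j ≡ + suc m - + j
    factor-< {j} j<d = trans (factor-true (b-d j<d))
      (cong (λ x → if x then + suc m - + j else + m) (dec-true (j ℕ.<? d) j<d))

    factor-≮ : ∀ {j} → b j ≡ true → ¬ (j < d) → factor j ≡ + m
    factor-≮ {j} e j≮d = trans (factor-true e)
      (cong (λ x → if x then + suc m - + j else + m) (dec-false (j ℕ.<? d) j≮d))

    ∑-last : ∀ {j} (xs : Vec (Fin (suc m)) j) → suc j ≤ n → Ok xs → ∀ c → b j ≡ c → Dec (j < d) →
      ∑ (List.allFin (suc m)) (λ x → ⟦ admissible? (xs ∷ʳ x) j ⟧) ≡ factor j
    ∑-last {j} xs j<n ok false bj _ =
      trans (∑-δ F x₀ (λ x x≢ → ⟦⟧-no (admissible? (xs ∷ʳ x) j)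
               (λ (e , _) → x≢ (trans (sym (at-last xs x)) (trans (sym e) (at-init xs x L<j))))))
      (trans (⟦⟧-yes (admissible? (xs ∷ʳ x₀) j)
               ( trans (at-init xs x₀ L<j) (sym (at-last xs x₀))
               -- The copied colour differs from that of label 0, because `L j` is positive and
               -- already satisfies this condition.
               , (λ 0<j e → proj₁ (proj₂ (ok (L j) L<j)) 0<L
                   (trans (sym (at-init xs x₀ 0<j)) (trans e (at-last xs x₀))))
               , (λ j<d → contradiction (trans (sym bj) (b-d j<d)) (λ ()))))
             (sym (factor-false bj)))
      where
      0<L : 0 < L j
      0<L = proj₁ (b-false j<n bj)
      L<j : L j < j
      L<j = proj₂ (b-false j<n bj)
      x₀ : Fin (suc m)
      x₀ = at xs (L j)
    ∑-last {j} xs j<n ok true bj (yes j<d) =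
      trans (∑-cong (List.allFin (suc m)) (λ x → ⟦⟧-cong (admissible? (xs ∷ʳ x) j) (avoid? xs j x)
               (λ (_ , _ , r) i i<j e → r j<d i i<j (trans (at-init xs x i<j) (trans e (sym (at-last xs x)))))
               (λ a → cong (at (xs ∷ʳ x)) (b-true j<n bj)
                    , (λ 0<j e → a 0 0<j (trans (sym (at-init xs x 0<j)) (trans e (at-last xs x))))
                    , (λ _ i i<j e → a i i<j (trans (sym (at-init xs x i<j)) (trans e (at-last xs x)))))))
      (trans (∑-avoid xs j (λ i i<j → proj₂ (proj₂ (ok i i<j)) (ℕP.<-trans i<j j<d)))
             (sym (factor-< j<d)))
    ∑-last {j} xs j<n ok true bj (no j≮d) =
      trans (∑-cong (List.allFin (suc m)) (λ x → ⟦⟧-cong (admissible? (xs ∷ʳ x) j) (avoid? xs 1 x)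
               (λ { (_ , q , _) zero _ e → q 0<j (trans (at-init xs x 0<j) (trans e (sym (at-last xs x))))
                  ; _ (suc _) (s≤s ()) })
               (λ a → cong (at (xs ∷ʳ x)) (b-true j<n bj)
                    , (λ _ e → a 0 (s≤s z≤n) (trans (sym (at-init xs x 0<j)) (trans e (at-last xs x))))
                    , (λ j<d → contradiction j<d j≮d))))
      (trans (∑-avoid xs 1 (λ { zero _ _ () ; (suc _) (s≤s ()) })) (sym (factor-≮ bj j≮d)))
      where
      0<j : 0 < j
      0<j = ℕP.≤-trans 1≤d (ℕP.≮⇒≥ j≮d)

  ∑-ok : ∀ j → j ≤ n → ∑ (colourings m j) (λ xs → ⟦ ok? xs ⟧) ≡ total j
  ∑-ok zero    _   = cong (_+ 0ℤ) (⟦⟧-yes (ok? []) (λ _ ()))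
  ∑-ok (suc j) j<n = begin
    ∑ (colourings m (suc j)) (λ xs → ⟦ ok? xs ⟧)
      ≡⟨ ∑-cartesianProductWith _∷ʳ_ (colourings m j) (List.allFin (suc m)) _ ⟩
    ∑ (colourings m j) (λ xs → ∑ (List.allFin (suc m)) (λ x → ⟦ ok? (xs ∷ʳ x) ⟧))
      ≡⟨ ∑-cong (colourings m j) inner ⟩
    ∑ (colourings m j) (λ xs → factor j * ⟦ ok? xs ⟧)
      ≡⟨ ∑-*ˡ (colourings m j) (factor j) _ ⟩
    factor j * ∑ (colourings m j) (λ xs → ⟦ ok? xs ⟧)
      ≡⟨ cong (factor j *_) (∑-ok j (ℕP.<⇒≤ j<n)) ⟩
    factor j * total j ∎
    where
    open ≡-Reasoning
    inner : ∀ xs → ∑ (List.allFin (suc m)) (λ x → ⟦ ok? (xs ∷ʳ x) ⟧) ≡ factor j * ⟦ ok? xs ⟧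
    inner xs with ok? xs
    ... | yes ok = trans (∑-cong (List.allFin (suc m)) (λ x → ⟦⟧-cong (ok? (xs ∷ʳ x)) (admissible? (xs ∷ʳ x) j)
                      (proj₂ ∘ Equivalence.to (ok-snoc xs x j<n)) (λ a → Equivalence.from (ok-snoc xs x j<n) (ok , a))))
                    (trans (∑-last xs j<n ok (b j) refl (j ℕ.<? d)) (sym (ℤP.*-identityʳ _)))
    ... | no ¬ok = trans (∑-cong (List.allFin (suc m)) (λ x → ⟦⟧-no (ok? (xs ∷ʳ x))
                      (¬ok ∘ proj₁ ∘ Equivalence.to (ok-snoc xs x j<n))))
                    (trans (∑-zero (List.allFin (suc m))) (sym (ℤP.*-zeroʳ (factor j))))

  private
    cnt-d : cnt b d ≡ d
    cnt-d = cnt-all-true b d b-d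

    total-≤d : ∀ j → j ≤ d → total j ≡ falling (+ suc m) j
    total-≤d zero    _   = refl
    total-≤d (suc j) j<d = trans (cong₂ _*_ (factor-< j<d) (total-≤d j (ℕP.<⇒≤ j<d))) (ℤP.*-comm (+ suc m - + j) _)

    total-≥d : ∀ t → total (t ℕ.+ d) ≡ falling (+ suc m) d * (+ m) ^ (cnt b (t ℕ.+ d) ∸ d)
    total-≥d zero = trans (total-≤d d ℕP.≤-refl) (sym (trans
      (cong (λ e → falling (+ suc m) d * (+ m) ^ e) (trans (cong (_∸ d) cnt-d) (ℕP.n∸n≡0 d)))
      (ℤP.*-identityʳ _)))
    total-≥d (suc t) = step-at (b (t ℕ.+ d)) refl
      where
      open ≡-Reasoning
      P : ℕ → ℤ
      P e = falling (+ suc m) d * (+ m) ^ e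
      arith : ∀ x y z → x * (y * z) ≡ y * (x * z)
      arith = solve-∀
      d≤cnt : d ≤ cnt b (t ℕ.+ d)
      d≤cnt = subst (_≤ cnt b (t ℕ.+ d)) cnt-d (cnt-mono b (ℕP.m≤n+m d t))
      step-at : ∀ c → b (t ℕ.+ d) ≡ c → total (suc t ℕ.+ d) ≡ P (cnt b (suc t ℕ.+ d) ∸ d)
      step-at false e = begin
        factor (t ℕ.+ d) * total (t ℕ.+ d) ≡⟨ cong₂ _*_ (factor-false e) (total-≥d t) ⟩
        1ℤ * P (cnt b (t ℕ.+ d) ∸ d)       ≡⟨ ℤP.*-identityˡ _ ⟩
        P (cnt b (t ℕ.+ d) ∸ d)            ≡⟨ cong (λ c → P (c ∸ d)) (sym (cnt-false b e)) ⟩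
        P (cnt b (suc t ℕ.+ d) ∸ d)        ∎
      step-at true e = begin
        factor (t ℕ.+ d) * total (t ℕ.+ d)   ≡⟨ cong₂ _*_ (factor-≮ e (ℕP.≤⇒≯ (ℕP.m≤n+m d t))) (total-≥d t) ⟩
        + m * P (cnt b (t ℕ.+ d) ∸ d)        ≡⟨ arith (+ m) (falling (+ suc m) d) _ ⟩
        P (suc (cnt b (t ℕ.+ d) ∸ d))        ≡⟨ cong P (sym (ℕP.+-∸-assoc 1 d≤cnt)) ⟩
        P (suc (cnt b (t ℕ.+ d)) ∸ d)        ≡⟨ cong (λ c → P (c ∸ d)) (sym (cnt-true b e)) ⟩
        P (cnt b (suc t ℕ.+ d) ∸ d)          ∎

  count-ok : d ≤ n → ∑ (colourings m n) (λ xs → ⟦ ok? xs ⟧) ≡ falling (+ suc m) d * (+ m) ^ (cnt b n ∸ d)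
  count-ok d≤n = trans (∑-ok n ℕP.≤-refl)
    (subst (λ j → total j ≡ falling (+ suc m) d * (+ m) ^ (cnt b j ∸ d)) (ℕP.m∸n+n≡m d≤n) (total-≥d (n ∸ d)))

-- Admissible colourings of a given orientation

ext-cong : {b b′ : Fin n → Bool} → (∀ v → b v ≡ b′ v) → ∀ i → ext b i ≡ ext b′ i
ext-cong {n} e i with i ℕ.<? n
... | yes p = e (fromℕ< p)
... | no  _ = refl

sink-path : {o : Orientation n} {u v : Fin n} → Sink o u → Path o u v → u ≡ v
sink-path snk here                 = refl
sink-path snk (step {v = w} a p) = contradiction (snk w) (true≢false a)

Separating : {k : ℕ} → ℕ → Vec (Fin k) n → Set
Separating {n} d c = ∀ (a b : Fin n) → toℕ a < d → toℕ b < d → a ≢ b → lookup c a ≢ lookup c b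

separating? : {k : ℕ} (d : ℕ) → Decidable (Separating {n} {k} d)
separating? d c = FP.all? λ a → FP.all? λ b → (toℕ a ℕ.<? d) →-dec ((toℕ b ℕ.<? d) →-dec
  (¬? (a FP.≟ b) →-dec ¬? (lookup c a FP.≟ lookup c b)))

Good : Graph n → ℕ → Fin n → Orientation n → Set
Good G d v₁ o = IsAcyclicOrientation G o × (∀ a → toℕ a < d → leader o a ≡ a)
  × Sink o v₁ × (∀ v → Sink o v → v ≡ v₁)

sink? : (o : Orientation n) → Decidable (Sink o)
sink? o v = FP.all? λ u → arc o v u Bool.≟ false

good? : ∀ (G : Graph n) d v₁ → Decidable (Good G d v₁)
good? G d v₁ o = (isOrientation? G o ×-dec acyclic? o)
  ×-dec (FP.all? λ a → (toℕ a ℕ.<? d) →-dec (leader o a FP.≟ a))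
  ×-dec sink? o v₁ ×-dec (FP.all? λ v → sink? o v →-dec (v FP.≟ v₁))

module FixedOrientation {n : ℕ} (G : Graph n) (d m : ℕ) (v₁ : Fin n) (v₁≡0 : toℕ v₁ ≡ 0)
  (1≤d : 1 ≤ d) (d≤n : d ≤ n)
  (clique : ∀ (a b : Fin n) → toℕ a < d → toℕ b < d → a ≢ b → adj G a b ≡ true)
  (lower : ∀ (k : Fin n) → 0 < toℕ k → ∃ λ (j : Fin n) → toℕ j < toℕ k × adj G k j ≡ true)
  (o : Orientation n) where

  Valid : Vec (Fin (suc m)) n → Set
  Valid c = Coloured.Valid G (lookup c v₁) (lookup c) o

  lead : Vec (Fin (suc m)) n → Vec (Fin n) n
  lead c = Coloured.lead G (lookup c v₁) (lookup c) o

  lead-c₀ : ∀ c {v} → lookup c v ≡ lookup c v₁ → lookup (lead c) v ≡ v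
  lead-c₀ c = Coloured.lead-c₀ G (lookup c v₁) (lookup c) o

  lead-≢c₀ : ∀ c {v} → lookup c v ≢ lookup c v₁ → lookup (lead c) v ≡ leader o v
  lead-≢c₀ c = Coloured.lead-≢c₀ G (lookup c v₁) (lookup c) o

  term : Vec (Fin (suc m)) n → ℤ
  term c = ⟦ separating? d c ⟧ * Coloured.weight G (lookup c v₁) (lookup c) o

  value : ℤ
  value = ⟦ good? G d v₁ o ⟧ * (signs (ext (isLeader o)) n * (+ m) ^ (leaders o n ∸ d))

  private
    term-yes : ∀ c → Separating d c → Valid c → term c ≡ signs (ext (fixes (lead c))) n
    term-yes c S V = trans (cong₂ _*_ (⟦⟧-yes (separating? d c) S) (Coloured.weight-valid G (lookup c v₁) (lookup c) V)) (ℤP.*-identityˡ _)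

    term-no : ∀ c → ¬ (Separating d c × Valid c) → term c ≡ 0ℤ
    term-no c ¬SV = case separating? d c of λ where
      (yes S) → trans (cong (⟦ separating? d c ⟧ *_) (Coloured.weight-invalid G (lookup c v₁) (lookup c) (λ V → ¬SV (S , V)))) (ℤP.*-zeroʳ ⟦ separating? d c ⟧)
      (no ¬S) → cong (_* Coloured.weight G (lookup c v₁) (lookup c) o) (⟦⟧-no (separating? d c) ¬S)

    term-support : ∀ c → term c ≢ 0ℤ → Separating d c × Valid c
    term-support c t≢0 = case separating? d c ×-dec Coloured.valid? G (lookup c v₁) (lookup c) o of λ where
      (yes SV) → SV
      (no ¬SV) → contradiction (term-no c ¬SV) t≢0

    value-bad : ¬ Good G d v₁ o → falling (+ suc m) d * value ≡ 0ℤ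
    value-bad ¬good = trans
      (cong (λ z → falling (+ suc m) d * (z * (signs (ext (isLeader o)) n * (+ m) ^ (leaders o n ∸ d)))) (⟦⟧-no (good? G d v₁ o) ¬good))
      (ℤP.*-zeroʳ (falling (+ suc m) d))

    ≢v₁⇒0< : ∀ {v} → v ≢ v₁ → 0 < toℕ v
    ≢v₁⇒0< {v} v≢ = ℕP.≤∧≢⇒< z≤n (λ e → v≢ (FP.toℕ-injective (trans (sym e) (sym v₁≡0))))

    leader-v₁ : leader o v₁ ≡ v₁
    leader-v₁ = FP.toℕ-injective (ℕP.≤-antisym (leader-≤ o v₁) (subst (_≤ toℕ (leader o v₁)) (sym v₁≡0) z≤n))

  module ExtraSink (O : IsAcyclicOrientation G o) (snk₁ : Sink o v₁) (s : Fin n) (snk : Sink o s) (s≢v₁ : s ≢ v₁) where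
    open Oriented G {o} (proj₁ O)

    private
      ℓ : Fin n
      ℓ = leader o s

      ℓ≢s : ℓ ≢ s
      ℓ≢s e with lower s (≢v₁⇒0< s≢v₁)
      ... | j , j<s , a with adj⇒arc a
      ...   | inj₁ b = true≢false b (snk j)
      ...   | inj₂ b = ℕP.<⇒≱ j<s (subst (λ x → toℕ x ≤ toℕ j) e (leader-min o (step b here)))

      -- No vertex follows `s`, so recolouring `s` disturbs no condition at another vertex.
      leader≢s : ∀ v → leader o v ≢ s
      leader≢s v e = ℓ≢s (trans (cong (leader o) (sym e)) (trans (leader-idem o v) e))

      -- Two sinks cannot be adjacent, so `s` lies outside the clique that contains `v₁`, and
      -- recolouring it keeps `Separating`.
      d≤s : ¬ (toℕ s < d)
      d≤s s<d with adj⇒arc (clique s v₁ s<d (subst (_< d) (sym v₁≡0) 1≤d) s≢v₁)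
      ... | inj₁ b = true≢false b (snk v₁)
      ... | inj₂ b = true≢false b (snk₁ s)

      new : Vec (Fin (suc m)) n → Fin (suc m)
      new c = if does (lookup c s FP.≟ lookup c v₁) then lookup c ℓ else lookup c v₁

      new-≡ : ∀ c → lookup c s ≡ lookup c v₁ → new c ≡ lookup c ℓ
      new-≡ c e = cong (λ x → if x then lookup c ℓ else lookup c v₁) (dec-true (lookup c s FP.≟ lookup c v₁) e)

      new-≢ : ∀ c → lookup c s ≢ lookup c v₁ → new c ≡ lookup c v₁
      new-≢ c e = cong (λ x → if x then lookup c ℓ else lookup c v₁) (dec-false (lookup c s FP.≟ lookup c v₁) e)

      record Swap (c c′ : Vec (Fin (suc m)) n) : Set where
        field
          to   : c′ ≡ c [ s ]≔ new c
          from : c ≡ c′ [ s ]≔ new c′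
          neg  : term c′ ≡ - term c

      swap : ∀ c → Separating d c → Valid c → ∃ (Swap c)
      swap c S V@(_ , snks , col) = c′ , record
        { to = refl
        ; from = sym (trans (VP.[]≔-idempotent c s) (trans (cong (c [ s ]≔_) back) (VP.[]≔-lookup c s)))
        ; neg = trans (term-yes c′ S′ V′) (trans (signs-ext-flip fix′ fix s off-s at-s) (cong -_ (sym (term-yes c S V)))) }
        where
        c′ : Vec (Fin (suc m)) n
        c′ = c [ s ]≔ new c
        c′-s : lookup c′ s ≡ new c
        c′-s = VP.lookup∘update s c (new c)
        c′-off : ∀ {v} → v ≢ s → lookup c′ v ≡ lookup c v
        c′-off v≢ = VP.lookup∘update′ v≢ c (new c)
        c′-v₁ : lookup c′ v₁ ≡ lookup c v₁
        c′-v₁ = c′-off (s≢v₁ ∘ sym)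
        ℓ-colour : lookup c ℓ ≢ lookup c v₁
        -- A leader with the colour of `v₁` would be a sink and could not reach `s`. Hence the two
        -- colours offered to `s` are different.
        ℓ-colour e = ℓ≢s (sink-path (snks ℓ e) (leader-path o s))
        cases : (lookup c s ≡ lookup c v₁ × lookup c′ s ≡ lookup c ℓ)
              ⊎ (lookup c s ≢ lookup c v₁ × lookup c′ s ≡ lookup c v₁)
        cases = case lookup c s FP.≟ lookup c v₁ of λ where
          (yes e) → inj₁ (e , trans c′-s (new-≡ c e))
          (no ¬e) → inj₂ (¬e , trans c′-s (new-≢ c ¬e))
        back : new c′ ≡ lookup c s
        back with cases
        ... | inj₁ (e , e′) = trans (new-≢ c′ (λ q → ℓ-colour (trans (sym e′) (trans q c′-v₁)))) (trans c′-v₁ (sym e))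
        ... | inj₂ (¬e , e′) = trans (new-≡ c′ (trans e′ (sym c′-v₁))) (trans (c′-off ℓ≢s) (col s ¬e))
        S′ : Separating d c′
        S′ a b a<d b<d a≢b e = S a b a<d b<d a≢b
          (trans (sym (c′-off (λ { refl → d≤s a<d }))) (trans e (c′-off (λ { refl → d≤s b<d }))))
        V′ : Valid c′
        V′ = O , snks′ , col′
          where
          snks′ : ∀ v → lookup c′ v ≡ lookup c′ v₁ → Sink o v
          snks′ v e with v FP.≟ s
          ... | yes refl = snk
          ... | no v≢    = snks v (trans (sym (c′-off v≢)) (trans e c′-v₁))
          col′ : ∀ v → lookup c′ v ≢ lookup c′ v₁ → lookup c′ (leader o v) ≡ lookup c′ v
          col′ v ¬e with v FP.≟ s
          ... | no v≢ = trans (c′-off (leader≢s v)) (trans (col v (λ e → ¬e (trans (c′-off v≢) (trans e (sym c′-v₁)))))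
                          (sym (c′-off v≢)))
          ... | yes refl with cases
          ...   | inj₁ (_ , e′) = trans (c′-off ℓ≢s) (sym e′)
          ...   | inj₂ (_ , e′) = contradiction (trans e′ (sym c′-v₁)) ¬e
        fix fix′ : Fin n → Bool
        fix  = fixes (lead c)
        fix′ = fixes (lead c′)
        off-s : ∀ {v} → v ≢ s → fix′ v ≡ fix v
        off-s {v} v≢ = cong (λ x → does (x FP.≟ v)) same
          where
          same : lookup (lead c′) v ≡ lookup (lead c) v
          same with lookup c v FP.≟ lookup c v₁
          ... | yes e = trans (lead-c₀ c′ (trans (c′-off v≢) (trans e (sym c′-v₁)))) (sym (lead-c₀ c e))
          ... | no ¬e = trans (lead-≢c₀ c′ (λ q → ¬e (trans (sym (c′-off v≢)) (trans q c′-v₁))))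
                              (sym (lead-≢c₀ c ¬e))
        fix-true : ∀ b → lookup b s ≡ lookup b v₁ → fixes (lead b) s ≡ true
        fix-true b e = dec-true (_ FP.≟ s) (lead-c₀ b e)
        fix-false : ∀ b → lookup b s ≢ lookup b v₁ → fixes (lead b) s ≡ false
        fix-false b ¬e = dec-false (_ FP.≟ s) (λ q → ℓ≢s (trans (sym (lead-≢c₀ b ¬e)) q))
        at-s : fix′ s ≡ not (fix s)
        at-s with cases
        ... | inj₁ (e , e′) = trans (fix-false c′ (λ q → ℓ-colour (trans (sym e′) (trans q c′-v₁))))
                                    (cong not (sym (fix-true c e)))
        ... | inj₂ (¬e , e′) = trans (fix-true c′ (trans e′ (sym c′-v₁))) (cong not (sym (fix-false c ¬e)))

    ∑-term : ∑ (colourings m n) term ≡ 0ℤ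
    ∑-term = ∑-involution (finiteVec (finiteFin (suc m)) n) Swap term
      (λ S → record { to = Swap.from S ; from = Swap.to S
                    ; neg = trans (sym (ℤP.neg-involutive _)) (cong -_ (sym (Swap.neg S))) })
      (λ S S′ → trans (Swap.to S) (sym (Swap.to S′)))
      Swap.neg
      (λ c t≢0 → let S , V = term-support c t≢0 in swap c S V)

  module UniqueSink (good : Good G d v₁ o) where
    private
      O : IsAcyclicOrientation G o
      O = proj₁ good
      leads : ∀ a → toℕ a < d → leader o a ≡ a
      leads = proj₁ (proj₂ good)
      snk₁ : Sink o v₁
      snk₁ = proj₁ (proj₂ (proj₂ good))
      only : ∀ v → Sink o v → v ≡ v₁
      only = proj₂ (proj₂ (proj₂ good))

      L : ℕ → ℕ
      L i with i ℕ.<? n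
      ... | yes p = toℕ (leader o (fromℕ< p))
      ... | no  _ = i

      L-toℕ : ∀ v → L (toℕ v) ≡ toℕ (leader o v)
      L-toℕ v with toℕ v ℕ.<? n
      ... | yes p = cong (toℕ ∘ leader o) (FP.fromℕ<-toℕ v p)
      ... | no ¬p = contradiction (FP.toℕ<n v) ¬p

      b : ℕ → Bool
      b = ext (isLeader o)

      at-index : ∀ {P : ℕ → Set} → (∀ v → P (toℕ v)) → ∀ i → i < n → P i
      at-index {P} p i i<n = subst P (FP.toℕ-fromℕ< i<n) (p (fromℕ< i<n))

      b-true : ∀ v → b (toℕ v) ≡ true → L (toℕ v) ≡ toℕ v
      b-true v e = trans (L-toℕ v) (cong toℕ (does-≡true (leader o v FP.≟ v) (trans (sym (ext-toℕ (isLeader o) v)) e)))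

      b-false : ∀ v → b (toℕ v) ≡ false → 0 < L (toℕ v) × L (toℕ v) < toℕ v
      -- The leader is not `v₁`: a sink reaches only itself, so `v₁` leads no other vertex.
      b-false v e rewrite L-toℕ v = ≢v₁⇒0< (λ q → ¬l (trans q (sink-path snk₁ (subst (λ x → Path o x v) q (leader-path o v)))))
        , ℕP.≤∧≢⇒< (leader-≤ o v) (¬l ∘ FP.toℕ-injective)
        where
        ¬l : leader o v ≢ v
        ¬l q = true≢false (trans (ext-toℕ (isLeader o) v) (dec-true (leader o v FP.≟ v) q)) e

      b-d : ∀ v → toℕ v < d → b (toℕ v) ≡ true
      b-d v v<d = trans (ext-toℕ (isLeader o) v) (dec-true (leader o v FP.≟ v) (leads v v<d))

      module Cnt = Counting m n d 1≤d b L
        (λ {i} i<n → at-index {λ i → b i ≡ true → L i ≡ i} b-true i i<n)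
        (λ {i} i<n → at-index {λ i → b i ≡ false → 0 < L i × L i < i} b-false i i<n)
        (λ {i} i<d → at-index {λ i → i < d → b i ≡ true} b-d i (ℕP.<-≤-trans i<d d≤n) i<d)

      at-0 : ∀ (c : Vec (Fin (suc m)) n) → at c 0 ≡ lookup c v₁
      at-0 c = trans (cong (at c) (sym v₁≡0)) (at-lookup c v₁)

      ok⇒separating : ∀ (c : Vec (Fin (suc m)) n) → Cnt.Ok c → Separating d c
      ok⇒separating c ok x y x<d y<d x≢y e with ℕP.<-cmp (toℕ x) (toℕ y)
      ... | tri< l _ _ = proj₂ (proj₂ (ok (toℕ y) (FP.toℕ<n y))) y<d (toℕ x) l
                           (trans (at-lookup c x) (trans e (sym (at-lookup c y))))
      ... | tri≈ _ q _ = x≢y (FP.toℕ-injective q)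
      ... | tri> _ _ l = proj₂ (proj₂ (ok (toℕ x) (FP.toℕ<n x))) x<d (toℕ y) l
                           (trans (at-lookup c y) (trans (sym e) (sym (at-lookup c x))))

      ok⇒valid : ∀ (c : Vec (Fin (suc m)) n) → Cnt.Ok c → Valid c
      ok⇒valid c ok = O , snks , col
        where
        snks : ∀ v → lookup c v ≡ lookup c v₁ → Sink o v
        snks v e with v FP.≟ v₁
        ... | yes refl = snk₁
        ... | no v≢ = contradiction (trans (at-0 c) (trans (sym e) (sym (at-lookup c v))))
                        (proj₁ (proj₂ (ok (toℕ v) (FP.toℕ<n v))) (≢v₁⇒0< v≢))
        col : ∀ v → lookup c v ≢ lookup c v₁ → lookup c (leader o v) ≡ lookup c v
        col v _ = trans (sym (at-lookup c (leader o v))) (trans (cong (at c) (sym (L-toℕ v)))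
                    (trans (proj₁ (ok (toℕ v) (FP.toℕ<n v))) (at-lookup c v)))

      -- A vertex coloured like `v₁` must be a sink and hence equals `v₁`. So every other vertex
      -- avoids that colour and has the colour of its leader.
      valid⇒ok : ∀ (c : Vec (Fin (suc m)) n) → Separating d c → Valid c → Cnt.Ok c
      valid⇒ok c S (_ , snks , col) = at-index {Cnt.Admissible c} λ v → follows v , differs v , distinct v
        where
        private-colour : ∀ v → v ≢ v₁ → lookup c v ≢ lookup c v₁
        private-colour v v≢ e = v≢ (only v (snks v e))
        follows : ∀ v → at c (L (toℕ v)) ≡ at c (toℕ v)
        follows v with v FP.≟ v₁
        ... | yes refl = cong (at c) (trans (L-toℕ v) (cong toℕ leader-v₁))
        ... | no v≢ = trans (cong (at c) (L-toℕ v)) (trans (at-lookup c (leader o v))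
                        (trans (col v (private-colour v v≢)) (sym (at-lookup c v))))
        differs : ∀ v → 0 < toℕ v → at c 0 ≢ at c (toℕ v)
        differs v 0<v e = private-colour v (λ { refl → ℕP.<-irrefl (sym v₁≡0) 0<v })
          (trans (sym (at-lookup c v)) (trans (sym e) (at-0 c)))
        distinct : ∀ v → toℕ v < d → ∀ i → i < toℕ v → at c i ≢ at c (toℕ v)
        distinct v v<d i i<v = at-index {λ i → i < toℕ v → at c i ≢ at c (toℕ v)}
          (λ u u<v e → S u v (ℕP.<-trans u<v v<d) v<d (λ { refl → ℕP.<-irrefl refl u<v })
            (trans (sym (at-lookup c u)) (trans e (at-lookup c v))))
          i (ℕP.<-trans i<v (FP.toℕ<n v)) i<v

      fixes≡isLeader : ∀ c → Valid c → ∀ v → fixes (lead c) v ≡ isLeader o v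
      fixes≡isLeader c (_ , snks , _) v with v FP.≟ v₁
      ... | yes refl = cong (λ x → does (x FP.≟ v)) (trans (lead-c₀ c refl) (sym leader-v₁))
      ... | no v≢ = cong (λ x → does (x FP.≟ v)) (lead-≢c₀ c (λ e → v≢ (only v (snks v e))))

      sgn : ℤ
      sgn = signs b n

      term≡ : ∀ c → term c ≡ sgn * ⟦ Cnt.ok? c ⟧
      term≡ c = case Cnt.ok? c of λ where
        (yes ok) → trans (term-yes c (ok⇒separating c ok) (ok⇒valid c ok))
          (trans (signs-cong n (λ {i} _ → ext-cong (fixes≡isLeader c (ok⇒valid c ok)) i))
                 (sym (trans (cong (sgn *_) (⟦⟧-yes (Cnt.ok? c) ok)) (ℤP.*-identityʳ sgn))))
        (no ¬ok) → trans (term-no c (λ (S , V) → ¬ok (valid⇒ok c S V)))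
          (sym (trans (cong (sgn *_) (⟦⟧-no (Cnt.ok? c) ¬ok)) (ℤP.*-zeroʳ sgn)))

    ∑-term : ∑ (colourings m n) term ≡ falling (+ suc m) d * value
    ∑-term = begin
      ∑ (colourings m n) term                                 ≡⟨ ∑-cong (colourings m n) term≡ ⟩
      ∑ (colourings m n) (λ c → sgn * ⟦ Cnt.ok? c ⟧)          ≡⟨ ∑-*ˡ (colourings m n) sgn _ ⟩
      sgn * ∑ (colourings m n) (λ c → ⟦ Cnt.ok? c ⟧)          ≡⟨ cong (sgn *_) (Cnt.count-ok d≤n) ⟩
      sgn * (falling (+ suc m) d * (+ m) ^ (leaders o n ∸ d)) ≡⟨ arith sgn (falling (+ suc m) d) _ ⟩
      falling (+ suc m) d * (1ℤ * (sgn * (+ m) ^ (leaders o n ∸ d)))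
        ≡⟨ cong (λ z → falling (+ suc m) d * (z * (sgn * (+ m) ^ (leaders o n ∸ d)))) (sym (⟦⟧-yes (good? G d v₁ o) good)) ⟩
      falling (+ suc m) d * value ∎
      where
      open ≡-Reasoning
      arith : ∀ x y z → x * (y * z) ≡ y * (1ℤ * (x * z))
      arith = solve-∀

  private
    vanish : (∀ c → Separating d c → ¬ Valid c) → ∑ (colourings m n) term ≡ 0ℤ
    vanish ¬V = trans (∑-cong (colourings m n) (λ c → term-no c (λ (S , V) → ¬V c S V))) (∑-zero (colourings m n))

    -- A vertex below `d` that is not a leader would share its colour with its leader, another
    -- vertex below `d`. It cannot escape by taking the colour of `v₁`, since it would then be a
    -- sink and equal `v₁`, which leads itself.
    unled : ¬ Good G d v₁ o → IsAcyclicOrientation G o → Sink o v₁ → (∀ v → Sink o v → v ≡ v₁) →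
      ∀ c → Separating d c → ¬ Valid c
    unled ¬good O snk₁ only c S (_ , snks , col) = ¬good (O , leads , snk₁ , only)
      where
      leads : ∀ a → toℕ a < d → leader o a ≡ a
      leads a a<d = decidable-stable (leader o a FP.≟ a) λ ¬l →
        S (leader o a) a (ℕP.≤-<-trans (leader-≤ o a) a<d) a<d ¬l
          (col a (λ e → ¬l (subst (λ x → leader o x ≡ x) (sym (only a (snks a e))) leader-v₁)))

    ∑-term-bad : ¬ Good G d v₁ o → Dec (IsAcyclicOrientation G o) → Dec (Sink o v₁) →
      Dec (∃ λ s → Sink o s × s ≢ v₁) → ∑ (colourings m n) term ≡ 0ℤ
    ∑-term-bad ¬good (no ¬O) _ _ = vanish (λ c _ V → ¬O (proj₁ V))
    ∑-term-bad ¬good (yes O) (no ¬snk₁) _ = vanish (λ c _ V → ¬snk₁ (proj₁ (proj₂ V) v₁ refl))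
    ∑-term-bad ¬good (yes O) (yes snk₁) (yes (s , snk , s≢)) = ExtraSink.∑-term O snk₁ s snk s≢
    ∑-term-bad ¬good (yes O) (yes snk₁) (no ¬extra) =
      vanish (unled ¬good O snk₁ (λ v snk → decidable-stable (v FP.≟ v₁) (λ v≢ → ¬extra (v , snk , v≢))))

    ∑-term-dec : Dec (Good G d v₁ o) → ∑ (colourings m n) term ≡ falling (+ suc m) d * value
    ∑-term-dec (yes good) = UniqueSink.∑-term good
    ∑-term-dec (no ¬good) = trans
      (∑-term-bad ¬good (isOrientation? G o ×-dec acyclic? o) (sink? o v₁) (FP.any? (λ s → sink? o s ×-dec ¬? (s FP.≟ v₁))))
      (sym (value-bad ¬good))

  ∑-term : ∑ (colourings m n) term ≡ falling (+ suc m) d * value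
  ∑-term = ∑-term-dec (good? G d v₁ o)

-- Polynomials as coefficient lists

_⊕_ : List ℤ → List ℤ → List ℤ
[]       ⊕ q        = q
(a ∷ p)  ⊕ []       = a ∷ p
(a ∷ p)  ⊕ (b ∷ q)  = (a + b) ∷ (p ⊕ q)

eval-⊕ : ∀ p q x → eval (p ⊕ q) x ≡ eval p x + eval q x
eval-⊕ []      q       x = sym (ℤP.+-identityˡ _)
eval-⊕ (a ∷ p) []      x = sym (ℤP.+-identityʳ _)
eval-⊕ (a ∷ p) (b ∷ q) x =
  trans (cong (λ z → a + b + x * z) (eval-⊕ p q x)) (arith a b x (eval p x) (eval q x))
  where
  arith : ∀ a b x y z → (a + b) + x * (y + z) ≡ (a + x * y) + (b + x * z)
  arith = solve-∀

coeff-⊕ : ∀ p q i → coeff (p ⊕ q) i ≡ coeff p i + coeff q i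
coeff-⊕ []      q       i       = sym (ℤP.+-identityˡ _)
coeff-⊕ (a ∷ p) []      i       = sym (ℤP.+-identityʳ _)
coeff-⊕ (a ∷ p) (b ∷ q) zero    = refl
coeff-⊕ (a ∷ p) (b ∷ q) (suc i) = coeff-⊕ p q i

⊖_ : List ℤ → List ℤ
⊖ p = List.map -_ p

eval-⊖ : ∀ p x → eval (⊖ p) x ≡ - eval p x
eval-⊖ []      x = refl
eval-⊖ (a ∷ p) x = trans (cong (λ z → - a + x * z) (eval-⊖ p x)) (arith a x (eval p x))
  where
  arith : ∀ a x y → - a + x * (- y) ≡ - (a + x * y)
  arith = solve-∀

coeff-⊖ : ∀ p i → coeff (⊖ p) i ≡ - coeff p i
coeff-⊖ []      i       = refl
coeff-⊖ (a ∷ p) zero    = refl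
coeff-⊖ (a ∷ p) (suc i) = coeff-⊖ p i

monomial : ℤ → ℕ → List ℤ
monomial a zero    = a ∷ []
monomial a (suc e) = 0ℤ ∷ monomial a e

eval-monomial : ∀ a e x → eval (monomial a e) x ≡ a * x ^ e
eval-monomial a zero    x = trans (cong (λ z → a + z) (ℤP.*-zeroʳ x)) (trans (ℤP.+-identityʳ a) (sym (ℤP.*-identityʳ a)))
eval-monomial a (suc e) x = trans (ℤP.+-identityˡ _) (trans (cong (x *_) (eval-monomial a e x)) (arith x a (x ^ e)))
  where
  arith : ∀ x a y → x * (a * y) ≡ a * (x * y)
  arith = solve-∀

coeff-monomial : ∀ a e i → coeff (monomial a e) i ≡ ⟦ e ℕ.≟ i ⟧ * a
coeff-monomial a e i = case e ℕ.≟ i of λ where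
    (yes refl) → trans (same e) (sym (trans (cong (_* a) (⟦⟧-yes (e ℕ.≟ e) refl)) (ℤP.*-identityˡ a)))
    (no e≢i)   → trans (other e i e≢i) (sym (cong (_* a) (⟦⟧-no (e ℕ.≟ i) e≢i)))
  where
  same : ∀ e → coeff (monomial a e) e ≡ a
  same zero    = refl
  same (suc e) = same e
  other : ∀ e i → e ≢ i → coeff (monomial a e) i ≡ 0ℤ
  other zero    zero    e≢i = contradiction refl e≢i
  other zero    (suc i) _   = refl
  other (suc e) zero    _   = refl
  other (suc e) (suc i) e≢i = other e i (e≢i ∘ cong suc)

∑-monomials : {A : Set} → List A → (A → ℤ) → (A → ℕ) → List ℤ
∑-monomials []       a e = []
∑-monomials (x ∷ xs) a e = monomial (a x) (e x) ⊕ ∑-monomials xs a e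

eval-∑-monomials : {A : Set} (xs : List A) (a : A → ℤ) (e : A → ℕ) → ∀ y →
  eval (∑-monomials xs a e) y ≡ ∑ xs (λ x → a x * y ^ e x)
eval-∑-monomials []       a e y = refl
eval-∑-monomials (x ∷ xs) a e y = trans (eval-⊕ (monomial (a x) (e x)) _ y)
  (cong₂ _+_ (eval-monomial (a x) (e x) y) (eval-∑-monomials xs a e y))

coeff-∑-monomials : {A : Set} (xs : List A) (a : A → ℤ) (e : A → ℕ) → ∀ i →
  coeff (∑-monomials xs a e) i ≡ ∑ xs (λ x → ⟦ e x ℕ.≟ i ⟧ * a x)
coeff-∑-monomials []       a e i = refl
coeff-∑-monomials (x ∷ xs) a e i = trans (coeff-⊕ (monomial (a x) (e x)) _ i)
  (cong₂ _+_ (coeff-monomial (a x) (e x) i) (coeff-∑-monomials xs a e i))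

-- The constant term a is divisible by every large m, hence zero.
eventually-zero⇒coeff≡0 : ∀ p N → (∀ m → N ≤ m → eval p (+ m) ≡ 0ℤ) → ∀ i → coeff p i ≡ 0ℤ
eventually-zero⇒coeff≡0 []      N z i = refl
eventually-zero⇒coeff≡0 (a ∷ p) N z = λ { zero → a≡0 ; (suc i) → eventually-zero⇒coeff≡0 p (suc N) z′ i }
  where
  M : ℕ
  M = N ℕ.⊔ suc ℤ.∣ a ∣
  E : ℤ
  E = eval p (+ M)
  ∣a∣≡ : ℤ.∣ a ∣ ≡ M ℕ.* ℤ.∣ E ∣
  ∣a∣≡ = begin
    ℤ.∣ a ∣          ≡⟨ cong ℤ.∣_∣ (arith a (+ M * E)) ⟩
    ℤ.∣ (a + + M * E) - + M * E ∣ ≡⟨ cong (λ x → ℤ.∣ x - + M * E ∣) (z M (ℕP.m≤m⊔n N _)) ⟩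
    ℤ.∣ 0ℤ - + M * E ∣ ≡⟨ cong ℤ.∣_∣ (ℤP.+-identityˡ (- (+ M * E))) ⟩
    ℤ.∣ - (+ M * E) ∣ ≡⟨ ℤP.∣-i∣≡∣i∣ (+ M * E) ⟩
    ℤ.∣ + M * E ∣    ≡⟨ ℤP.∣i*j∣≡∣i∣*∣j∣ (+ M) E ⟩
    M ℕ.* ℤ.∣ E ∣    ∎
    where
    open ≡-Reasoning
    arith : ∀ x y → x ≡ (x + y) - y
    arith = solve-∀
  vanish : ∀ k → ℤ.∣ a ∣ ≡ M ℕ.* k → ℤ.∣ a ∣ ≡ 0
  vanish zero    e = trans e (ℕP.*-zeroʳ M)
  vanish (suc k) e = contradiction (ℕP.≤-trans (ℕP.m≤m*n M (suc k)) (ℕP.≤-reflexive (sym e)))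
                       (ℕP.<⇒≱ (ℕP.m≤n⊔m N (suc ℤ.∣ a ∣)))
  a≡0 : a ≡ 0ℤ
  a≡0 = ℤP.∣i∣≡0⇒i≡0 (vanish ℤ.∣ E ∣ ∣a∣≡)
  z′ : ∀ m → suc N ≤ m → eval p (+ m) ≡ 0ℤ
  z′ (suc m) N<m with ℤP.i*j≡0⇒i≡0∨j≡0 (+ suc m) (trans (sym (ℤP.+-identityˡ _))
                        (trans (cong (_+ (+ suc m) * eval p (+ suc m)) (sym a≡0)) (z (suc m) (ℕP.<⇒≤ N<m))))
  ... | inj₂ e = e

-- Agreement at all large arguments suffices, which leaves room for arguments at which a common
-- factor cannot be cancelled.
coeff-unique : ∀ p q N → (∀ m → N ≤ m → eval p (+ m) ≡ eval q (+ m)) → ∀ i → coeff p i ≡ coeff q i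
coeff-unique p q N e i = ℤP.i-j≡0⇒i≡j _ _ (trans (cong (λ x → coeff p i + x) (sym (coeff-⊖ q i)))
  (trans (sym (coeff-⊕ p (⊖ q) i)) (eventually-zero⇒coeff≡0 (p ⊕ (⊖ q)) N zeros i)))
  where
  zeros : ∀ m → N ≤ m → eval (p ⊕ (⊖ q)) (+ m) ≡ 0ℤ
  zeros m N≤m = trans (eval-⊕ p (⊖ q) (+ m)) (trans (cong (λ x → eval p (+ m) + x) (eval-⊖ q (+ m)))
    (ℤP.i≡j⇒i-j≡0 (e m N≤m)))

falling≢0 : ∀ m d → d ≤ suc m → falling (+ suc m) d ≢ 0ℤ
falling≢0 m zero    _   ()
falling≢0 m (suc d) d<m e with ℤP.i*j≡0⇒i≡0∨j≡0 (falling (+ suc m) d) e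
... | inj₁ e′ = falling≢0 m d (ℕP.<⇒≤ d<m) e′
... | inj₂ e′ = ℕP.<⇒≢ d<m (sym (ℤP.+-injective (ℤP.i-j≡0⇒i≡j (+ suc m) (+ d) e′)))

cnt≤ : ∀ b j → cnt b j ≤ j
cnt≤ b zero    = z≤n
cnt≤ b (suc j) with b j
... | true  = s≤s (cnt≤ b j)
... | false = ℕP.m≤n⇒m≤1+n (cnt≤ b j)

signs≡sign : ∀ b j → signs b j ≡ sign (j ∸ cnt b j)
signs≡sign b zero    = refl
signs≡sign b (suc j) with b j
... | true  = trans (ℤP.*-identityˡ _) (signs≡sign b j)
... | false = trans (cong (-1ℤ *_) (signs≡sign b j)) (cong sign (sym (ℕP.+-∸-assoc 1 (cnt≤ b j))))

sign*sign : ∀ k → sign k * sign k ≡ 1ℤ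
sign*sign zero    = refl
sign*sign (suc k) = trans (arith (sign k)) (sign*sign k)
  where
  arith : ∀ x → (-1ℤ * x) * (-1ℤ * x) ≡ x * x
  arith = solve-∀

-- Comparison of the two evaluations

module Main {n : ℕ} (G : Graph n) (d : ℕ) (v₁ : Fin n) (v₁≡0 : toℕ v₁ ≡ 0) (1≤d : 1 ≤ d) (d≤n : d ≤ n)
  (clique : ∀ (a b : Fin n) → toℕ a < d → toℕ b < d → a ≢ b → adj G a b ≡ true)
  (lower : ∀ (k : Fin n) → 0 < toℕ k → ∃ λ (j : Fin n) → toℕ j < toℕ k × adj G k j ≡ true) where

  private
    module At (m : ℕ) (o : Orientation n) where
      open FixedOrientation G d m v₁ v₁≡0 1≤d d≤n clique lower o public using (term; value; ∑-term)

  coefficient : Orientation n → ℤ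
  coefficient o = ⟦ good? G d v₁ o ⟧ * signs (ext (isLeader o)) n

  degree : Orientation n → ℕ
  degree o = leaders o n ∸ d

  -- The variable is `m`, one less than the number of colours, so this list already represents the
  -- shifted polynomial, the reduced chromatic polynomial at q + 1.
  χ̂ : List ℤ
  χ̂ = ∑-monomials (orientations n) coefficient degree

  properColouring? : ∀ m → Decidable (ProperColoring G (suc m))
  properColouring? m c = Coloured.proper? G (lookup c v₁) (lookup c)

  private
    ∑-term-proper : ∀ m c → ∑ (orientations n) (λ o → At.term m o c) ≡ ⟦ properColouring? m c ⟧
    ∑-term-proper m c = case separating? d c of λ where
        (yes S) → trans (∑-cong (orientations n) (λ o → trans (cong (_* weight o) (⟦⟧-yes (separating? d c) S)) (ℤP.*-identityˡ _)))
                        (Coloured.∑-weight G (lookup c v₁) (lookup c))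
        -- A colouring that repeats a colour on the first `d` vertices is improper, as these form a
        -- clique; both sides vanish.
        (no ¬S) → trans (∑-cong (orientations n) (λ o → cong (_* weight o) (⟦⟧-no (separating? d c) ¬S)))
                    (trans (∑-zero (orientations n)) (sym (⟦⟧-no (properColouring? m c)
                      (λ P → ¬S (λ a b a<d b<d a≢b → P a b (clique a b a<d b<d a≢b))))))
      where
      weight : Orientation n → ℤ
      weight = Coloured.weight G (lookup c v₁) (lookup c)

  ∑-proper : ∀ m → ∑ (colourings m n) (λ c → ⟦ properColouring? m c ⟧) ≡ eval χ̂ (+ m) * falling (+ suc m) d
  ∑-proper m = begin
    ∑ (colourings m n) (λ c → ⟦ properColouring? m c ⟧)
      ≡⟨ ∑-cong (colourings m n) (λ c → sym (∑-term-proper m c)) ⟩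
    ∑ (colourings m n) (λ c → ∑ (orientations n) (λ o → At.term m o c))
      ≡⟨ ∑-swap (colourings m n) (orientations n) (λ c o → At.term m o c) ⟩
    ∑ (orientations n) (λ o → ∑ (colourings m n) (At.term m o))
      ≡⟨ ∑-cong (orientations n) (λ o → At.∑-term m o) ⟩
    ∑ (orientations n) (λ o → falling (+ suc m) d * At.value m o)
      ≡⟨ ∑-*ˡ (orientations n) (falling (+ suc m) d) (At.value m) ⟩
    falling (+ suc m) d * ∑ (orientations n) (At.value m)
      ≡⟨ ℤP.*-comm (falling (+ suc m) d) _ ⟩
    ∑ (orientations n) (At.value m) * falling (+ suc m) d
      ≡⟨ cong (_* falling (+ suc m) d) (trans
           (∑-cong (orientations n) (λ o → sym (ℤP.*-assoc ⟦ good? G d v₁ o ⟧ (signs (ext (isLeader o)) n) ((+ m) ^ degree o))))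
           (sym (eval-∑-monomials (orientations n) coefficient degree (+ m)))) ⟩
    eval χ̂ (+ m) * falling (+ suc m) d ∎
    where open ≡-Reasoning

  Evaluates : List ℤ → Set
  Evaluates p = ∀ (m c : ℕ) → HasCard (ProperColoring G (suc m)) c → + c ≡ eval p (+ m) * falling (+ suc m) d

  evaluates-χ̂ : Evaluates χ̂
  evaluates-χ̂ m c card = trans (card≡∑ (finiteVec (finiteFin (suc m)) n) (properColouring? m) card) (∑-proper m)

  evaluates⇒coeff≡ : ∀ p → Evaluates p → ∀ i → coeff p i ≡ coeff χ̂ i
  -- With too few colours the falling factorial vanishes; from `m = d` on it is nonzero and can be
  -- cancelled.
  evaluates⇒coeff≡ p ev = coeff-unique p χ̂ d λ m d≤m →
    ℤP.*-cancelʳ-≡ _ _ (falling (+ suc m) d) {{ℤ.≢-nonZero (falling≢0 m d (ℕP.m≤n⇒m≤1+n d≤m))}}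
      (trans (sym (ev m _ (hasCard (finiteVec (finiteFin (suc m)) n) (properColouring? m))))
             (evaluates-χ̂ m _ (hasCard (finiteVec (finiteFin (suc m)) n) (properColouring? m))))

  private
    -- This makes the truncated subtraction in `degree` exact on every good orientation.
    d≤leaders : ∀ {o} → Good G d v₁ o → d ≤ leaders o n
    d≤leaders {o} (_ , leads , _) = subst (_≤ leaders o n) (cnt-all-true b d b-true) (cnt-mono b d≤n)
      where
      b : ℕ → Bool
      b = ext (isLeader o)
      b-true : ∀ {i} → i < d → b i ≡ true
      b-true {i} i<d = subst (λ j → b j ≡ true) (FP.toℕ-fromℕ< i<n)
        (trans (ext-toℕ (isLeader o) v) (dec-true (leader o v FP.≟ v) (leads v (subst (_< d) (sym (FP.toℕ-fromℕ< i<n)) i<d))))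
        where
        i<n : i < n
        i<n = ℕP.<-≤-trans i<d d≤n
        v : Fin n
        v = fromℕ< i<n

  counted⇔ : ∀ i o → Counted G d i v₁ o ⇔ (Good G d v₁ o × degree o ≡ i)
  counted⇔ i o = mk⇔
    (λ (O , num , sep , snk , only) → (O , Equivalence.to (separated⇔ o d) sep , snk , only)
      , trans (cong (_∸ d) (Equivalence.to (numSourceComponents⇔ o (d ℕ.+ i)) num)) (ℕP.m+n∸m≡n d i))
    (λ (g@(O , leads , snk , only) , e) → O
      , Equivalence.from (numSourceComponents⇔ o (d ℕ.+ i)) (trans (sym (ℕP.m+[n∸m]≡n (d≤leaders g))) (cong (d ℕ.+_) e))
      , Equivalence.from (separated⇔ o d) leads , snk , only)

  counted? : ∀ i → Decidable (Counted G d i v₁)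
  counted? i o = map′ (Equivalence.from (counted⇔ i o)) (Equivalence.to (counted⇔ i o))
    (good? G d v₁ o ×-dec (degree o ℕ.≟ i))

  private
    -- A good orientation of degree `i` has `d + i` leaders, hence the sign of `n ∸ d ∸ i`, which
    -- the prefactor squares away. For all others both sides are zero, so truncation of the exponent
    -- does no harm.
    signed : ∀ i o → sign (n ∸ d ∸ i) * (⟦ degree o ℕ.≟ i ⟧ * coefficient o) ≡ ⟦ counted? i o ⟧
    signed i o = case good? G d v₁ o ×-dec (degree o ℕ.≟ i) of λ where
        (yes (g , e)) → trans
          (cong₂ (λ x y → sign (n ∸ d ∸ i) * (x * y)) (⟦⟧-yes (degree o ℕ.≟ i) e)
            (trans (cong₂ _*_ (⟦⟧-yes (good? G d v₁ o) g) (trans (signs≡sign (ext (isLeader o)) n) (cong sign (exponent g e))))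
                   (ℤP.*-identityˡ _)))
          (trans (cong (sign (n ∸ d ∸ i) *_) (ℤP.*-identityˡ _)) (trans (sign*sign (n ∸ d ∸ i))
            (sym (⟦⟧-yes (counted? i o) (Equivalence.from (counted⇔ i o) (g , e))))))
        (no ¬ge) → trans (cong (sign (n ∸ d ∸ i) *_) (none ¬ge)) (trans (ℤP.*-zeroʳ (sign (n ∸ d ∸ i)))
            (sym (⟦⟧-no (counted? i o) (λ c → ¬ge (Equivalence.to (counted⇔ i o) c)))))
      where
      exponent : Good G d v₁ o → degree o ≡ i → n ∸ leaders o n ≡ n ∸ d ∸ i
      exponent g e = trans (cong (n ∸_) (trans (sym (ℕP.m+[n∸m]≡n (d≤leaders g))) (cong (d ℕ.+_) e)))
                           (sym (ℕP.∸-+-assoc n d i))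
      none : ¬ (Good G d v₁ o × degree o ≡ i) → ⟦ degree o ℕ.≟ i ⟧ * coefficient o ≡ 0ℤ
      none ¬ge = case degree o ℕ.≟ i of λ where
        (yes e) → trans (cong (λ x → ⟦ degree o ℕ.≟ i ⟧ * (x * signs (ext (isLeader o)) n))
                          (⟦⟧-no (good? G d v₁ o) (λ g → ¬ge (g , e)))) (ℤP.*-zeroʳ ⟦ degree o ℕ.≟ i ⟧)
        (no ¬e) → cong (_* coefficient o) (⟦⟧-no (degree o ℕ.≟ i) ¬e)

  coeff-χ̂ : ∀ i c → HasCard (Counted G d i v₁) c → sign (n ∸ d ∸ i) * coeff χ̂ i ≡ + c
  coeff-χ̂ i c card = begin
    sign (n ∸ d ∸ i) * coeff χ̂ i
      ≡⟨ cong (sign (n ∸ d ∸ i) *_) (coeff-∑-monomials (orientations n) coefficient degree i) ⟩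
    sign (n ∸ d ∸ i) * ∑ (orientations n) (λ o → ⟦ degree o ℕ.≟ i ⟧ * coefficient o)
      ≡⟨ sym (∑-*ˡ (orientations n) (sign (n ∸ d ∸ i)) _) ⟩
    ∑ (orientations n) (λ o → sign (n ∸ d ∸ i) * (⟦ degree o ℕ.≟ i ⟧ * coefficient o))
      ≡⟨ ∑-cong (orientations n) (signed i) ⟩
    ∑ (orientations n) (λ o → ⟦ counted? i o ⟧)
      ≡⟨ sym (card≡∑ (finiteVec (finiteVec finiteBool n) n) (counted? i) card) ⟩
    + c ∎
    where open ≡-Reasoning

theorem4p7 : (n : ℕ) (G : Graph n) (d : ℕ) (1≤d : 1 ≤ d) (d≤n : d ≤ n) →
    Connected G →
    (∀ (a b : Fin n) → toℕ a < d → toℕ b < d → a ≢ b → adj G a b ≡ true) →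
    (∀ (k : Fin n) → 0 < toℕ k → ∃ λ (j : Fin n) → toℕ j < toℕ k × adj G k j ≡ true) →
    (Σ (List ℤ) λ p → ∀ (m c : ℕ) → HasCard (ProperColoring G (suc m)) c →
    + c ≡ eval p (+ m) * falling (+ suc m) d)
    ×
    (∀ (p : List ℤ) →
    (∀ (m c : ℕ) → HasCard (ProperColoring G (suc m)) c →
    + c ≡ eval p (+ m) * falling (+ suc m) d) →
    ∀ (i c : ℕ) →
    HasCard (Counted G d i (fromℕ< (≤-trans 1≤d d≤n))) c →
    sign (n ∸ d ∸ i) * coeff p i ≡ + c)
theorem4p7 n G d 1≤d d≤n _ clique lower =
  (χ̂ , evaluates-χ̂) , λ p ev i c card →
    trans (cong (sign (n ∸ d ∸ i) *_) (evaluates⇒coeff≡ p ev i)) (coeff-χ̂ i c card)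
  where
  open Main G d (fromℕ< (≤-trans 1≤d d≤n)) (FP.toℕ-fromℕ< (≤-trans 1≤d d≤n)) 1≤d d≤n clique lower
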